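{- For $n\ge1$, $$\sum_{\pi\in\mathcal I_n(321)} q^{\mathrm{maj}(\pi)}=\binom{n}{\lfloor \frac{n}{2} \rfloor}_q.$$
   Context: $\mathcal I_n(321)$ is the set of involutions of $\{1,\dots,n\}$ avoiding the pattern $321$. $\mathrm{maj}(\pi)=\sum_{i:\pi(i)>\pi(i+1)} i$ is the major index. $\binom{n}{j}_q=\frac{(1-q^n)\cdots(1-q^{n-j+1})}{(1-q^j)\cdots(1-q)}$ is the $q$-binomial coefficient. -}

module Defs where

open import Data.Bool using (Bool; true; false; if_then_else_; _∧_; not)
open import Data.Nat using (ℕ; zero; suc; _∸_; _<ᵇ_; _≡ᵇ_) renaming (_+_ to _+ℕ_)
open import Data.Fin using (Fin; toℕ)
open import Data.Vec using (Vec; []; _∷_; lookup; toList)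
open import Data.List using (List; []; _∷_; [_]; map; concatMap; filter; foldr; allFin; upTo; length)
open import Data.Bool.ListAction using (all; any)
open import Data.Integer using (ℤ; +_; -_) renaming (_+_ to _+ℤ_; _*_ to _*ℤ_)
open import Function using (_∘_)
open import Relation.Nullary.Decidable using (does)
open import Data.Bool.Properties using (T?)

-- Permutations of {1..n} are represented as vectors π : Vec (Fin n) n,
-- with π(i) = lookup π i (values/positions 0-indexed internally).

allVecs : (n m : ℕ) → List (Vec (Fin n) m)
allVecs n zero    = [ [] ]
allVecs n (suc m) = concatMap (λ x → map (x ∷_) (allVecs n m)) (allFin n)

-- π is an involution: π(π(i)) = i for all i (this already forces π to be a bijection)
isInvolution : ∀ {n} → Vec (Fin n) n → Bool
isInvolution {n} π = all (λ i → toℕ (lookup π (lookup π i)) ≡ᵇ toℕ i) (allFin n)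

contains321 : ∀ {n} → Vec (Fin n) n → Bool
contains321 {n} π =
  any (λ i → any (λ j → any (λ k →
        (toℕ i <ᵇ toℕ j) ∧ (toℕ j <ᵇ toℕ k) ∧
        (toℕ (lookup π j) <ᵇ toℕ (lookup π i)) ∧
        (toℕ (lookup π k) <ᵇ toℕ (lookup π j)))
      (allFin n)) (allFin n)) (allFin n)

avoids321 : ∀ {n} → Vec (Fin n) n → Bool
avoids321 π = not (contains321 π)

I321 : (n : ℕ) → List (Vec (Fin n) n)
I321 n = filter (λ π → T? (isInvolution π ∧ avoids321 π)) (allVecs n n)

majFrom : ℕ → List ℕ → ℕ
majFrom p []           = 0
majFrom p (x ∷ [])     = 0
majFrom p (x ∷ y ∷ xs) = (if y <ᵇ x then p else 0) +ℕ majFrom (suc p) (y ∷ xs)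

maj : ∀ {n} → Vec (Fin n) n → ℕ
maj π = majFrom 1 (toList (Data.Vec.map toℕ π))

Poly : Set
Poly = List ℤ

coeff : Poly → ℕ → ℤ
coeff []       _       = + 0
coeff (a ∷ p)  zero    = a
coeff (a ∷ p)  (suc k) = coeff p k

-- polynomial equality (coefficientwise, so trailing zeros are irrelevant)
_≈P_ : Poly → Poly → Set
p ≈P r = ∀ k → coeff p k Relation.Binary.PropositionalEquality.≡ coeff r k
  where import Relation.Binary.PropositionalEquality

_+P_ : Poly → Poly → Poly
[]      +P r       = r
(a ∷ p) +P []      = a ∷ p
(a ∷ p) +P (b ∷ r) = (a +ℤ b) ∷ (p +P r)

scale : ℤ → Poly → Poly
scale c = map (c *ℤ_)

_*P_ : Poly → Poly → Poly
[]      *P r = []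
(a ∷ p) *P r = scale a r +P (+ 0 ∷ (p *P r))

oneP : Poly
oneP = [ + 1 ]

qPow : ℕ → Poly
qPow zero    = oneP
qPow (suc k) = + 0 ∷ qPow k

oneMinusQPow : ℕ → Poly
oneMinusQPow k = oneP +P scale (- (+ 1)) (qPow k)

sumP : List Poly → Poly
sumP = foldr _+P_ []

prodP : List Poly → Poly
prodP = foldr _*P_ oneP

majGF : ℕ → Poly
majGF n = sumP (map (qPow ∘ maj) (I321 n))

qbinomNumer : ℕ → ℕ → Poly
qbinomNumer n j = prodP (map (λ i → oneMinusQPow (n ∸ i)) (upTo j))

qbinomDenom : ℕ → Poly
qbinomDenom j = prodP (map (λ i → oneMinusQPow (suc i)) (upTo j))

-- "f = [n choose j]_q" for a polynomial f, i.e. f * denom = numer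
-- (denom is a nonzero polynomial in the integral domain ℤ[q]).
IsQBinom : Poly → ℕ → ℕ → Set
IsQBinom f n j = (f *P qbinomDenom j) ≈P qbinomNumer n j

{-# OPTIONS --safe #-}

-- Mark position i of a 321-avoiding involution π by U, F or D according to whether π(i) > i, π(i) = i or π(i) < i.
-- Since π avoids 321, its 2-cycles are non-nesting and no fixed point lies under a 2-cycle, so the marks form a
-- path of nonnegative height from 0 to 0 whose flat steps have height 0, and conversely such a path determines π:
-- each D is matched with the earliest unmatched U.  The descents of π are the peaks UD of the path.
-- Removing the last step shows that the generating function W(n,h) of the paths ending at height h satisfies
-- W(n+2,h) = W(n+1,h-1) + W(n+1,h+1) - (1 - q^(n+1)) W(n,h), with W(n+1,0) in place of W(n+1,h-1) for h = 0, and the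
-- q-binomial coefficients [n, ⌊(n-h)/2⌋] satisfy the same recurrence.

module Submission where

open import Defs
open import Algebra.Bundles using (CommutativeRing)
open import Data.Bool using (Bool; true; false; if_then_else_; not; T; _∧_)
open import Data.Bool.ListAction using (all; any)
open import Data.Bool.Properties using (T-≡; T-∧; T?)
open import Data.Empty using (⊥; ⊥-elim)
open import Data.Fin using (Fin; toℕ; fromℕ<)
import Data.Fin.Properties as Fin
open import Data.Integer using (0ℤ; 1ℤ; -1ℤ; -_) renaming (_+_ to _+ℤ_; _*_ to _*ℤ_)
import Data.Integer.Properties as ℤ
open import Data.List as List
  using (List; []; _∷_; [_]; map; _++_; _∷ʳ_; length; upTo; applyUpTo; allFin; cartesianProductWith)
import Data.List.Properties as List
open import Data.List.Membership.Propositional using (_∈_; lose)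
open import Data.List.Membership.Propositional.Properties
  using (∈-allFin; ∈-filter⁺; ∈-filter⁻; ∈-map⁺; ∈-map⁻; ∈-++⁺ˡ; ∈-++⁺ʳ; ∈-cartesianProductWith⁺)
open import Data.List.Membership.Propositional.Properties.WithK using (unique∧set⇒bag)
open import Data.List.Relation.Binary.BagAndSetEquality using (∼bag⇒↭)
open import Data.List.Relation.Binary.Permutation.Propositional as Perm using (_↭_)
open import Data.List.Relation.Unary.All as All using ([]; _∷_)
import Data.List.Relation.Unary.All.Properties as All
open import Data.List.Relation.Unary.AllPairs using ([]; _∷_)
open import Data.List.Relation.Unary.Any as Any using (here)
import Data.List.Relation.Unary.Any.Properties as Any
open import Data.List.Relation.Unary.Unique.Propositional using (Unique)
import Data.List.Relation.Unary.Unique.Propositional.Properties as Unique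
open import Data.Maybe using (Maybe; just; nothing)
open import Data.Nat
open import Data.Nat.DivMod using (m≡m%n+[m/n]*n; m%n<n)
open import Data.Nat.Properties
open import Algebra.Properties.CommutativeSemigroup +-commutativeSemigroup using (x∙yz≈y∙xz)
open import Data.Nat.Tactic.RingSolver renaming (solve-∀ to solveℕ) using ()
open import Data.Product using (Σ; ∃; _×_; _,_; proj₁; proj₂)
open import Data.Sum using (inj₁; inj₂)
open import Data.Unit using (tt)
open import Data.Vec as Vec using (Vec; []; _∷_; lookup; tabulate; toList)
import Data.Vec.Properties as Vec
open import Function using (_∘_; case_of_)
open import Function.Bundles using (Equivalence; mk⇔)
open import Level using (0ℓ)
open import Relation.Binary.Bundles using (Setoid)
open import Relation.Binary.Definitions using (tri<; tri≈; tri>)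
open import Relation.Binary.PropositionalEquality
  using (_≡_; _≢_; _≗_; refl; sym; trans; cong; cong₂; subst; subst₂; module ≡-Reasoning)
open import Relation.Binary.Structures using (IsEquivalence)
open import Relation.Nullary using (¬_; yes; no; contradiction; toSum)
open import Tactic.RingSolver renaming (solve-∀ to solvePoly) using ()
open import Tactic.RingSolver.Core.AlmostCommutativeRing using (AlmostCommutativeRing; fromCommutativeRing)

-- The geometry of the 2-cycles enters through pairs of positions: whenever x < y and π(y) < π(x),
-- both x < π(x) and π(y) < y. Unlike the pattern 321, this involves only two positions, so it can
-- be followed through the insertion of a single 2-cycle, and for adjacent positions it says at once
-- that a descent is a U followed by a D. A prefix of a path is not yet an involution of its
-- positions: unmatched U's need partners beyond it, which is why the involutions live on all of ℕ.
--
-- The boundary case h = 0 of the recurrence is where the floor matters: the closed form read at h =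
-- -1 is [n+1, ⌊(n+2)/2⌋], and this equals its value [n+1, ⌊(n+1)/2⌋] at h = 0, trivially or by the
-- symmetry of the q-binomial according to the parity of n.
--
-- No division of polynomials occurs: the q-binomials are built by Pascal's rule, and every quotient
-- identity is proved in multiplied-out form.

-- The ring of polynomials

-- _≈P_ unfolds to a Π-type, from which Agda cannot recover the two polynomials; a record type can be used in a setoid.
record _≋_ (p r : Poly) : Set where
  constructor mk
  field at : p ≈P r

open _≋_

infix 4 _≋_

≋-isEquivalence : IsEquivalence _≋_
≋-isEquivalence = record
  { refl  = mk λ _ → refl
  ; sym   = λ e → mk λ k → sym (at e k)
  ; trans = λ e f → mk λ k → trans (at e k) (at f k)
  }

open IsEquivalence ≋-isEquivalence using () renaming (refl to ≋-refl; sym to ≋-sym; trans to ≋-trans)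

polySetoid : Setoid 0ℓ 0ℓ
polySetoid = record { isEquivalence = ≋-isEquivalence }

≋-reflexive : ∀ {p r} → p ≡ r → p ≋ r
≋-reflexive refl = ≋-refl

module ≋-Reasoning where
  open import Relation.Binary.Reasoning.Setoid polySetoid public

coeff-+P : ∀ p r k → coeff (p +P r) k ≡ coeff p k +ℤ coeff r k
coeff-+P []      r       k       = sym (ℤ.+-identityˡ _)
coeff-+P (a ∷ p) []      k       = sym (ℤ.+-identityʳ _)
coeff-+P (a ∷ p) (b ∷ r) zero    = refl
coeff-+P (a ∷ p) (b ∷ r) (suc k) = coeff-+P p r k

coeff-scale : ∀ c p k → coeff (scale c p) k ≡ c *ℤ coeff p k
coeff-scale c []      k       = sym (ℤ.*-zeroʳ c)
coeff-scale c (a ∷ p) zero    = refl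
coeff-scale c (a ∷ p) (suc k) = coeff-scale c p k

-P_ : Poly → Poly
-P p = scale -1ℤ p

+P-cong : ∀ {p p′ r r′} → p ≋ p′ → r ≋ r′ → p +P r ≋ p′ +P r′
+P-cong {p} {p′} {r} {r′} e f = mk λ k → begin
  coeff (p +P r) k         ≡⟨ coeff-+P p r k ⟩
  coeff p k +ℤ coeff r k   ≡⟨ cong₂ _+ℤ_ (at e k) (at f k) ⟩
  coeff p′ k +ℤ coeff r′ k ≡⟨ coeff-+P p′ r′ k ⟨
  coeff (p′ +P r′) k       ∎
  where open ≡-Reasoning

+P-comm : ∀ p r → p +P r ≋ r +P p
+P-comm p r = mk λ k → trans (coeff-+P p r k) (trans (ℤ.+-comm (coeff p k) _) (sym (coeff-+P r p k)))

+P-assoc : ∀ p r s → (p +P r) +P s ≋ p +P (r +P s)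
+P-assoc p r s = mk λ k → begin
  coeff ((p +P r) +P s) k                ≡⟨ coeff-+P (p +P r) s k ⟩
  coeff (p +P r) k +ℤ coeff s k          ≡⟨ cong (_+ℤ coeff s k) (coeff-+P p r k) ⟩
  (coeff p k +ℤ coeff r k) +ℤ coeff s k  ≡⟨ ℤ.+-assoc (coeff p k) _ _ ⟩
  coeff p k +ℤ (coeff r k +ℤ coeff s k)  ≡⟨ cong (coeff p k +ℤ_) (coeff-+P r s k) ⟨
  coeff p k +ℤ coeff (r +P s) k          ≡⟨ coeff-+P p (r +P s) k ⟨
  coeff (p +P (r +P s)) k                ∎
  where open ≡-Reasoning

+P-identityˡ : ∀ p → [] +P p ≋ p
+P-identityˡ p = ≋-refl

+P-identityʳ : ∀ p → p +P [] ≋ p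
+P-identityʳ p = +P-comm p []

scale-cong : ∀ {c p r} → p ≋ r → scale c p ≋ scale c r
scale-cong {c} {p} {r} e = mk λ k →
  trans (coeff-scale c p k) (trans (cong (c *ℤ_) (at e k)) (sym (coeff-scale c r k)))

-P-cong : ∀ {p r} → p ≋ r → -P p ≋ -P r
-P-cong = scale-cong { -1ℤ}

+P-inverseʳ : ∀ p → p +P (-P p) ≋ []
+P-inverseʳ p = mk λ k → begin
  coeff (p +P (-P p)) k               ≡⟨ coeff-+P p (-P p) k ⟩
  coeff p k +ℤ coeff (-P p) k         ≡⟨ cong (coeff p k +ℤ_) (coeff-scale -1ℤ p k) ⟩
  coeff p k +ℤ -1ℤ *ℤ coeff p k       ≡⟨ cong (coeff p k +ℤ_) (ℤ.-1*i≡-i (coeff p k)) ⟩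
  coeff p k +ℤ - coeff p k            ≡⟨ ℤ.+-inverseʳ (coeff p k) ⟩
  0ℤ                                  ∎
  where open ≡-Reasoning

+P-inverseˡ : ∀ p → (-P p) +P p ≋ []
+P-inverseˡ p = ≋-trans (+P-comm (-P p) p) (+P-inverseʳ p)

∷-cong : ∀ {a b p r} → a ≡ b → p ≋ r → a ∷ p ≋ b ∷ r
∷-cong e f = mk λ { zero → e ; (suc k) → at f k }

scale-+P : ∀ c p r → scale c (p +P r) ≋ scale c p +P scale c r
scale-+P c p r = mk λ k → begin
  coeff (scale c (p +P r)) k                    ≡⟨ coeff-scale c (p +P r) k ⟩
  c *ℤ coeff (p +P r) k                         ≡⟨ cong (c *ℤ_) (coeff-+P p r k) ⟩
  c *ℤ (coeff p k +ℤ coeff r k)                 ≡⟨ ℤ.*-distribˡ-+ c (coeff p k) _ ⟩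
  c *ℤ coeff p k +ℤ c *ℤ coeff r k              ≡⟨ cong₂ _+ℤ_ (coeff-scale c p k) (coeff-scale c r k) ⟨
  coeff (scale c p) k +ℤ coeff (scale c r) k    ≡⟨ coeff-+P (scale c p) (scale c r) k ⟨
  coeff (scale c p +P scale c r) k              ∎
  where open ≡-Reasoning

scale-scale : ∀ c d p → scale c (scale d p) ≋ scale (c *ℤ d) p
scale-scale c d p = mk λ k → begin
  coeff (scale c (scale d p)) k ≡⟨ coeff-scale c (scale d p) k ⟩
  c *ℤ coeff (scale d p) k      ≡⟨ cong (c *ℤ_) (coeff-scale d p k) ⟩
  c *ℤ (d *ℤ coeff p k)         ≡⟨ ℤ.*-assoc c d _ ⟨
  (c *ℤ d) *ℤ coeff p k         ≡⟨ coeff-scale (c *ℤ d) p k ⟨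
  coeff (scale (c *ℤ d) p) k    ∎
  where open ≡-Reasoning

scale-0 : ∀ p → scale 0ℤ p ≋ []
scale-0 p = mk λ k → coeff-scale 0ℤ p k

scale-1 : ∀ p → scale 1ℤ p ≋ p
scale-1 p = mk λ k → trans (coeff-scale 1ℤ p k) (ℤ.*-identityˡ _)

0∷[] : [ 0ℤ ] ≋ []
0∷[] = mk λ { zero → refl ; (suc k) → refl }

+P-interchange : ∀ p r s t → (p +P r) +P (s +P t) ≋ (p +P s) +P (r +P t)
+P-interchange p r s t = begin
  (p +P r) +P (s +P t)  ≈⟨ +P-assoc p r (s +P t) ⟩
  p +P (r +P (s +P t))  ≈⟨ +P-cong (≋-refl {p}) (+P-assoc r s t) ⟨
  p +P ((r +P s) +P t)  ≈⟨ +P-cong (≋-refl {p}) (+P-cong (+P-comm r s) (≋-refl {t})) ⟩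
  p +P ((s +P r) +P t)  ≈⟨ +P-cong (≋-refl {p}) (+P-assoc s r t) ⟩
  p +P (s +P (r +P t))  ≈⟨ +P-assoc p s (r +P t) ⟨
  (p +P s) +P (r +P t)  ∎
  where open ≋-Reasoning

*P-zeroʳ : ∀ p → p *P [] ≋ []
*P-zeroʳ []      = ≋-refl
*P-zeroʳ (a ∷ p) = ≋-trans (∷-cong refl (*P-zeroʳ p)) 0∷[]

*P-congˡ : ∀ p {r s} → r ≋ s → p *P r ≋ p *P s
*P-congˡ []      e = ≋-refl
*P-congˡ (a ∷ p) e = +P-cong (scale-cong {a} e) (∷-cong refl (*P-congˡ p e))

-- Mirrors the defining recursion of `_*P_` in the other factor, so that commutativity needs
-- induction on one factor only.
*P-∷ʳ : ∀ p a r → p *P (a ∷ r) ≋ scale a p +P (0ℤ ∷ (p *P r))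
*P-∷ʳ []      a r = ≋-sym 0∷[]
*P-∷ʳ (b ∷ p) a r = ∷-cong (cong (_+ℤ 0ℤ) (ℤ.*-comm b a)) (begin
  scale b r +P (p *P (a ∷ r))                   ≈⟨ +P-cong (≋-refl {scale b r}) (*P-∷ʳ p a r) ⟩
  scale b r +P (scale a p +P (0ℤ ∷ (p *P r)))   ≈⟨ +P-assoc (scale b r) (scale a p) _ ⟨
  (scale b r +P scale a p) +P (0ℤ ∷ (p *P r))   ≈⟨ +P-cong (+P-comm (scale b r) (scale a p)) ≋-refl ⟩
  (scale a p +P scale b r) +P (0ℤ ∷ (p *P r))   ≈⟨ +P-assoc (scale a p) (scale b r) _ ⟩
  scale a p +P (scale b r +P (0ℤ ∷ (p *P r)))   ∎)
  where open ≋-Reasoning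

*P-comm : ∀ p r → p *P r ≋ r *P p
*P-comm []      r = ≋-sym (*P-zeroʳ r)
*P-comm (a ∷ p) r = ≋-trans (+P-cong (≋-refl {scale a r}) (∷-cong refl (*P-comm p r))) (≋-sym (*P-∷ʳ r a p))

*P-cong : ∀ {p p′ r r′} → p ≋ p′ → r ≋ r′ → p *P r ≋ p′ *P r′
*P-cong {p} {p′} {r} {r′} e f = begin
  p *P r    ≈⟨ *P-congˡ p f ⟩
  p *P r′   ≈⟨ *P-comm p r′ ⟩
  r′ *P p   ≈⟨ *P-congˡ r′ e ⟩
  r′ *P p′  ≈⟨ *P-comm r′ p′ ⟩
  p′ *P r′  ∎
  where open ≋-Reasoning

*P-distribˡ : ∀ p r s → p *P (r +P s) ≋ (p *P r) +P (p *P s)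
*P-distribˡ []      r s = ≋-refl
*P-distribˡ (a ∷ p) r s = ≋-trans
  (+P-cong (scale-+P a r s) (∷-cong refl (*P-distribˡ p r s)))
  (+P-interchange (scale a r) (scale a s) (0ℤ ∷ (p *P r)) (0ℤ ∷ (p *P s)))

*P-distribʳ : ∀ p r s → (r +P s) *P p ≋ (r *P p) +P (s *P p)
*P-distribʳ p r s = ≋-trans (*P-comm (r +P s) p)
  (≋-trans (*P-distribˡ p r s) (+P-cong (*P-comm p r) (*P-comm p s)))

scale-*P : ∀ c p r → scale c p *P r ≋ scale c (p *P r)
scale-*P c []      r = ≋-refl
scale-*P c (a ∷ p) r = ≋-trans
  (+P-cong (≋-sym (scale-scale c a r)) (∷-cong (sym (ℤ.*-zeroʳ c)) (scale-*P c p r)))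
  (≋-sym (scale-+P c (scale a r) (0ℤ ∷ (p *P r))))

0∷-*P : ∀ p r → (0ℤ ∷ p) *P r ≋ 0ℤ ∷ (p *P r)
0∷-*P p r = +P-cong (scale-0 r) (≋-refl {0ℤ ∷ (p *P r)})

*P-assoc : ∀ p r s → (p *P r) *P s ≋ p *P (r *P s)
*P-assoc []      r s = ≋-refl
*P-assoc (a ∷ p) r s = begin
  (scale a r +P (0ℤ ∷ (p *P r))) *P s            ≈⟨ *P-distribʳ s (scale a r) _ ⟩
  (scale a r *P s) +P ((0ℤ ∷ (p *P r)) *P s)     ≈⟨ +P-cong (scale-*P a r s) (0∷-*P (p *P r) s) ⟩
  scale a (r *P s) +P (0ℤ ∷ ((p *P r) *P s))     ≈⟨ +P-cong (≋-refl {scale a (r *P s)}) (∷-cong refl (*P-assoc p r s)) ⟩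
  scale a (r *P s) +P (0ℤ ∷ (p *P (r *P s)))     ∎
  where open ≋-Reasoning

*P-identityˡ : ∀ p → oneP *P p ≋ p
*P-identityˡ p = ≋-trans (+P-cong (scale-1 p) 0∷[]) (+P-identityʳ p)

*P-identityʳ : ∀ p → p *P oneP ≋ p
*P-identityʳ p = ≋-trans (*P-comm p oneP) (*P-identityˡ p)

polyRing : CommutativeRing 0ℓ 0ℓ
polyRing = record
  { Carrier = Poly ; _≈_ = _≋_ ; _+_ = _+P_ ; _*_ = _*P_ ; -_ = -P_ ; 0# = [] ; 1# = oneP
  ; isCommutativeRing = record
    { isRing = record
      { +-isAbelianGroup = record
        { isGroup = record
          { isMonoid = record
            { isSemigroup = record
              { isMagma = record { isEquivalence = ≋-isEquivalence ; ∙-cong = +P-cong }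
              ; assoc = +P-assoc
              }
            ; identity = +P-identityˡ , +P-identityʳ
            }
          ; inverse = +P-inverseˡ , +P-inverseʳ
          ; ⁻¹-cong = -P-cong
          }
        ; comm = +P-comm
        }
      ; *-cong = *P-cong
      ; *-assoc = *P-assoc
      ; *-identity = *P-identityˡ , *P-identityʳ
      ; distrib = *P-distribˡ , *P-distribʳ
      }
    ; *-comm = *P-comm
    }
  }

-- Lets the ring solver discard coefficients that cancel.
[]≋? : ∀ p → Maybe ([] ≋ p)
[]≋? []      = just ≋-refl
[]≋? (a ∷ p) with 0ℤ ℤ.≟ a | []≋? p
... | yes refl | just e = just (≋-trans (≋-sym 0∷[]) (∷-cong refl e))
... | _        | _      = nothing

polyACR : AlmostCommutativeRing 0ℓ 0ℓ
polyACR = fromCommutativeRing polyRing []≋?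

open AlmostCommutativeRing polyACR using (1#)
  renaming (_+_ to infixl 6 _⊕_; _*_ to infixl 7 _⊗_; -_ to infix 8 ⊖_)

-- q-binomial coefficients

qPow-+ : ∀ m n → qPow (m + n) ≋ qPow m ⊗ qPow n
qPow-+ zero    n = ≋-sym (*P-identityˡ (qPow n))
qPow-+ (suc m) n = ≋-trans (∷-cong refl (qPow-+ m n)) (≋-sym (0∷-*P (qPow m) (qPow n)))

infix 9 1-q^_

1-q^_ : ℕ → Poly
1-q^_ = oneMinusQPow

1-q^-+ : ∀ m n → 1-q^ (m + n) ≋ 1# ⊕ (⊖ (qPow m ⊗ qPow n))
1-q^-+ m n = +P-cong (≋-refl {oneP}) (-P-cong (qPow-+ m n))

-- gauss a b is the q-binomial coefficient [a + b, a].
gauss : ℕ → ℕ → Poly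
gauss zero    b       = oneP
gauss (suc a) zero    = oneP
gauss (suc a) (suc b) = qPow (suc a) ⊗ gauss (suc a) b ⊕ gauss a (suc b)

gauss-zeroʳ : ∀ a → gauss a 0 ≡ oneP
gauss-zeroʳ zero    = refl
gauss-zeroʳ (suc a) = refl

module _ where
  open ≋-Reasoning

  -- In the `pascal-` lemmas `x` and `y` stand for q^(a+1) and q^(b+1), `P` and `R` for
  -- `gauss (suc a) b` and `gauss a (suc b)`, and the hypothesis for `gauss-exchange a b`. With
  -- these abstracted, one use of the hypothesis separates two identities that the ring solver
  -- proves.
  pascal-absorbˡ : ∀ x y P R → (1# ⊕ (⊖ x)) ⊗ P ≋ (1# ⊕ (⊖ y)) ⊗ R →
                   (1# ⊕ (⊖ x)) ⊗ (x ⊗ P ⊕ R) ≋ (1# ⊕ (⊖ (x ⊗ y))) ⊗ R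
  pascal-absorbˡ x y P R e = begin
    (1# ⊕ (⊖ x)) ⊗ (x ⊗ P ⊕ R)                            ≈⟨ expand x P R ⟩
    x ⊗ ((1# ⊕ (⊖ x)) ⊗ P) ⊕ (1# ⊕ (⊖ x)) ⊗ R             ≈⟨ +P-cong (*P-congˡ x e) ≋-refl ⟩
    x ⊗ ((1# ⊕ (⊖ y)) ⊗ R) ⊕ (1# ⊕ (⊖ x)) ⊗ R             ≈⟨ collect x y R ⟩
    (1# ⊕ (⊖ (x ⊗ y))) ⊗ R                                ∎
    where
    expand : ∀ x P R → (1# ⊕ (⊖ x)) ⊗ (x ⊗ P ⊕ R) ≋ x ⊗ ((1# ⊕ (⊖ x)) ⊗ P) ⊕ (1# ⊕ (⊖ x)) ⊗ R
    expand = solvePoly polyACR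
    collect : ∀ x y R → x ⊗ ((1# ⊕ (⊖ y)) ⊗ R) ⊕ (1# ⊕ (⊖ x)) ⊗ R ≋ (1# ⊕ (⊖ (x ⊗ y))) ⊗ R
    collect = solvePoly polyACR

  -- Both forms of Pascal's rule equal P + R minus the common value of (1 - x) P and (1 - y) R.
  pascal-swap : ∀ x y P R → (1# ⊕ (⊖ x)) ⊗ P ≋ (1# ⊕ (⊖ y)) ⊗ R → x ⊗ P ⊕ R ≋ y ⊗ R ⊕ P
  pascal-swap x y P R e = begin
    x ⊗ P ⊕ R                               ≈⟨ expand x P R ⟩
    P ⊕ (R ⊕ (⊖ ((1# ⊕ (⊖ x)) ⊗ P)))        ≈⟨ +P-cong (≋-refl {P}) (+P-cong (≋-refl {R}) (-P-cong e)) ⟩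
    P ⊕ (R ⊕ (⊖ ((1# ⊕ (⊖ y)) ⊗ R)))        ≈⟨ collect y P R ⟩
    y ⊗ R ⊕ P                               ∎
    where
    expand : ∀ x P R → x ⊗ P ⊕ R ≋ P ⊕ (R ⊕ (⊖ ((1# ⊕ (⊖ x)) ⊗ P)))
    expand = solvePoly polyACR
    collect : ∀ y P R → P ⊕ (R ⊕ (⊖ ((1# ⊕ (⊖ y)) ⊗ R))) ≋ y ⊗ R ⊕ P
    collect = solvePoly polyACR

  pascal-absorbʳ : ∀ x y P R → (1# ⊕ (⊖ x)) ⊗ P ≋ (1# ⊕ (⊖ y)) ⊗ R →
                   (1# ⊕ (⊖ y)) ⊗ (x ⊗ P ⊕ R) ≋ (1# ⊕ (⊖ (x ⊗ y))) ⊗ P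
  pascal-absorbʳ x y P R e = begin
    (1# ⊕ (⊖ y)) ⊗ (x ⊗ P ⊕ R)  ≈⟨ *P-congˡ (1# ⊕ (⊖ y)) (pascal-swap x y P R e) ⟩
    (1# ⊕ (⊖ y)) ⊗ (y ⊗ R ⊕ P)  ≈⟨ pascal-absorbˡ y x R P (≋-sym e) ⟩
    (1# ⊕ (⊖ (y ⊗ x))) ⊗ P      ≈⟨ *P-cong (+P-cong (≋-refl {oneP}) (-P-cong (*P-comm y x))) (≋-refl {P}) ⟩
    (1# ⊕ (⊖ (x ⊗ y))) ⊗ P      ∎

mutual
  -- The two absorption identities have the same right-hand side, so at (a, b) they give
  -- `gauss-exchange a b`, which is the hypothesis of the Pascal step to the next value of a + b.
  -- Hence no factor ever has to be cancelled.
  gauss-absorbˡ : ∀ a b → 1-q^ (suc a) ⊗ gauss (suc a) b ≋ 1-q^ (suc (a + b)) ⊗ gauss a b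
  gauss-absorbˡ a zero    = ≋-reflexive (cong₂ (λ m p → 1-q^ (suc m) ⊗ p) (sym (+-identityʳ a)) (sym (gauss-zeroʳ a)))
  gauss-absorbˡ a (suc b) = ≋-trans
    (pascal-absorbˡ (qPow (suc a)) (qPow (suc b)) (gauss (suc a) b) (gauss a (suc b)) (gauss-exchange a b))
    (*P-cong (≋-sym (1-q^-+ (suc a) (suc b))) ≋-refl)

  gauss-absorbʳ : ∀ a b → 1-q^ (suc b) ⊗ gauss a (suc b) ≋ 1-q^ (suc (a + b)) ⊗ gauss a b
  gauss-absorbʳ zero    b = ≋-refl
  gauss-absorbʳ (suc a) b = ≋-trans
    (pascal-absorbʳ (qPow (suc a)) (qPow (suc b)) (gauss (suc a) b) (gauss a (suc b)) (gauss-exchange a b))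
    (*P-cong (≋-trans (≋-sym (1-q^-+ (suc a) (suc b))) (≋-reflexive (cong (1-q^_ ∘ suc) (+-suc a b)))) ≋-refl)

  gauss-exchange : ∀ a b → 1-q^ (suc a) ⊗ gauss (suc a) b ≋ 1-q^ (suc b) ⊗ gauss a (suc b)
  gauss-exchange a b = ≋-trans (gauss-absorbˡ a b) (≋-sym (gauss-absorbʳ a b))

-- The second form of Pascal's rule is the first with a and b exchanged.
gauss-sym : ∀ a b → gauss a b ≋ gauss b a
gauss-sym zero    b       = ≋-reflexive (sym (gauss-zeroʳ b))
gauss-sym (suc a) zero    = ≋-refl
gauss-sym (suc a) (suc b) = ≋-trans
  (pascal-swap (qPow (suc a)) (qPow (suc b)) (gauss (suc a) b) (gauss a (suc b)) (gauss-exchange a b))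
  (+P-cong (*P-congˡ (qPow (suc b)) (gauss-sym a (suc b))) (gauss-sym (suc a) b))

-- Writing q^(a+1) as 1 - (1 - q^(a+1)) in Pascal's rule leaves a correction that absorption turns
-- into a multiple of `gauss a b` by a factor depending on a + b alone, as the path recurrence
-- requires.
gauss-rec : ∀ a b → gauss (suc a) (suc b) ≋
            (gauss (suc a) b ⊕ gauss a (suc b)) ⊕ (⊖ (1-q^ (suc (a + b)) ⊗ gauss a b))
gauss-rec a b = ≋-trans (expand (qPow (suc a)) (gauss (suc a) b) (gauss a (suc b)))
  (+P-cong (≋-refl {gauss (suc a) b ⊕ gauss a (suc b)}) (-P-cong (gauss-absorbˡ a b)))
  where
  expand : ∀ x P R → x ⊗ P ⊕ R ≋ (P ⊕ R) ⊕ (⊖ ((1# ⊕ (⊖ x)) ⊗ P))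
  expand = solvePoly polyACR

prodP-∷ʳ : ∀ ps p → prodP (ps ∷ʳ p) ≋ prodP ps ⊗ p
prodP-∷ʳ []       p = *P-comm p oneP
prodP-∷ʳ (r ∷ ps) p = ≋-trans (*P-congˡ r (prodP-∷ʳ ps p)) (≋-sym (*P-assoc r (prodP ps) p))

qbinomDenom-suc : ∀ j → qbinomDenom (suc j) ≋ qbinomDenom j ⊗ 1-q^ (suc j)
qbinomDenom-suc j = begin
  prodP (map (1-q^_ ∘ suc) (upTo (suc j)))            ≡⟨ cong (prodP ∘ map (1-q^_ ∘ suc)) (List.upTo-∷ʳ j) ⟨
  prodP (map (1-q^_ ∘ suc) (upTo j ∷ʳ j))             ≡⟨ cong prodP (List.map-++ (1-q^_ ∘ suc) (upTo j) _) ⟩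
  prodP (map (1-q^_ ∘ suc) (upTo j) ∷ʳ 1-q^ (suc j))     ≈⟨ prodP-∷ʳ (map (1-q^_ ∘ suc) (upTo j)) (1-q^ (suc j)) ⟩
  qbinomDenom j ⊗ 1-q^ (suc j)                       ∎
  where open ≋-Reasoning

qbinomNumer-suc : ∀ n j → qbinomNumer (suc n) (suc j) ≡ 1-q^ (suc n) ⊗ qbinomNumer n j
qbinomNumer-suc n j = cong (λ ps → 1-q^ (suc n) ⊗ prodP ps) (begin
  map (λ i → 1-q^ (suc n ∸ i)) (applyUpTo suc j)   ≡⟨ List.map-applyUpTo suc (λ i → 1-q^ (suc n ∸ i)) j ⟩
  applyUpTo (λ i → 1-q^ (n ∸ i)) j                 ≡⟨ List.map-applyUpTo (λ i → i) (λ i → 1-q^ (n ∸ i)) j ⟨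
  map (λ i → 1-q^ (n ∸ i)) (upTo j)                ∎)
  where open ≡-Reasoning

gauss-isQBinom : ∀ a b → gauss a b ⊗ qbinomDenom a ≋ qbinomNumer (a + b) a
gauss-isQBinom zero    b = *P-identityˡ oneP
gauss-isQBinom (suc a) b = begin
  gauss (suc a) b ⊗ qbinomDenom (suc a)                       ≈⟨ *P-congˡ (gauss (suc a) b) (qbinomDenom-suc a) ⟩
  gauss (suc a) b ⊗ (qbinomDenom a ⊗ 1-q^ (suc a))               ≈⟨ rotate (gauss (suc a) b) (qbinomDenom a) (1-q^ (suc a)) ⟩
  (1-q^ (suc a) ⊗ gauss (suc a) b) ⊗ qbinomDenom a               ≈⟨ *P-cong (gauss-absorbˡ a b) ≋-refl ⟩
  (1-q^ (suc (a + b)) ⊗ gauss a b) ⊗ qbinomDenom a             ≈⟨ *P-assoc (1-q^ (suc (a + b))) (gauss a b) (qbinomDenom a) ⟩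
  1-q^ (suc (a + b)) ⊗ (gauss a b ⊗ qbinomDenom a)             ≈⟨ *P-congˡ (1-q^ (suc (a + b))) (gauss-isQBinom a b) ⟩
  1-q^ (suc (a + b)) ⊗ qbinomNumer (a + b) a                 ≡⟨ qbinomNumer-suc (a + b) a ⟨
  qbinomNumer (suc a + b) (suc a)                           ∎
  where
  open ≋-Reasoning
  rotate : ∀ x y z → x ⊗ (y ⊗ z) ≋ (z ⊗ x) ⊗ y
  rotate = solvePoly polyACR

-- Paths and their generating function

-- Path n h: words of length n and final height h, the outermost constructor being the last letter.
data Path : ℕ → ℕ → Set where
  ε : Path 0 0
  F : ∀ {n} → Path n 0 → Path (suc n) 0
  U : ∀ {n h} → Path n h → Path (suc n) (suc h)
  D : ∀ {n h} → Path n (suc h) → Path (suc n) h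

allPaths : ∀ n h → List (Path n h)
allPaths zero    zero    = [ ε ]
allPaths zero    (suc h) = []
allPaths (suc n) zero    = map F (allPaths n 0) ++ map D (allPaths n 1)
allPaths (suc n) (suc h) = map U (allPaths n h) ++ map D (allPaths n (suc (suc h)))

-- What a D appended to the path adds to the major index: after a U, the position of that U counted
-- from 1.
peak : ∀ {n h} → Path n h → ℕ
peak {suc n} (U p) = suc n
peak         _     = 0

pathMaj : ∀ {n h} → Path n h → ℕ
pathMaj ε     = 0
pathMaj (F p) = pathMaj p
pathMaj (U p) = pathMaj p
pathMaj (D p) = peak p + pathMaj p

∑ : ∀ {A : Set} → (A → Poly) → List A → Poly
∑ f xs = sumP (map f xs)

∑-map-++-map : ∀ {A B C : Set} (f : C → Poly) (g : A → C) (g′ : B → C) xs ys →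
               ∑ f (map g xs ++ map g′ ys) ≋ ∑ (f ∘ g) xs ⊕ ∑ (f ∘ g′) ys
∑-map-++-map f g g′ []       ys = ≋-reflexive (cong sumP (sym (List.map-∘ ys)))
∑-map-++-map f g g′ (x ∷ xs) ys = ≋-trans
  (+P-cong (≋-refl {f (g x)}) (∑-map-++-map f g g′ xs ys))
  (≋-sym (+P-assoc (f (g x)) (∑ (f ∘ g) xs) (∑ (f ∘ g′) ys)))

∑-↭ : ∀ {A : Set} (f : A → Poly) {xs ys} → xs ↭ ys → ∑ f xs ≋ ∑ f ys
∑-↭ f Perm.refl         = ≋-refl
∑-↭ f (Perm.prep x e)   = +P-cong (≋-refl {f x}) (∑-↭ f e)
∑-↭ f (Perm.swap {xs} {ys} x y e) = ≋-trans (≋-sym (+P-assoc (f x) (f y) (∑ f xs)))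
  (≋-trans (+P-cong (+P-comm (f x) (f y)) (∑-↭ f e)) (+P-assoc (f y) (f x) (∑ f ys)))
∑-↭ f (Perm.trans e e′) = ≋-trans (∑-↭ f e) (∑-↭ f e′)

∑-qPow-+ : ∀ {A : Set} c (m : A → ℕ) xs → ∑ (λ x → qPow (c + m x)) xs ≋ qPow c ⊗ ∑ (qPow ∘ m) xs
∑-qPow-+ c m []       = ≋-sym (*P-zeroʳ (qPow c))
∑-qPow-+ c m (x ∷ xs) = ≋-trans (+P-cong (qPow-+ c (m x)) (∑-qPow-+ c m xs))
  (≋-sym (*P-distribˡ (qPow c) (qPow (m x)) (∑ (qPow ∘ m) xs)))

pathGF : ℕ → ℕ → Poly
pathGF n h = ∑ (qPow ∘ pathMaj) (allPaths n h)

-- The weight of a final D depends on the letter before it, so paths ending in D get a series of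
-- their own, which `pathGF-D-rec` then eliminates.
pathGF-D : ℕ → ℕ → Poly
pathGF-D n h = ∑ (qPow ∘ pathMaj ∘ D) (allPaths n (suc h))

-- Appending D to a path of positive height changes its weight only if the path ends in U, and then
-- by the factor q^(n+1); the correction is therefore 1 - q^(n+1) times the series of the paths with
-- that U removed.
pathGF-D-rec : ∀ n h → pathGF-D (suc n) h ≋ pathGF (suc n) (suc h) ⊕ (⊖ (1-q^ (suc n) ⊗ pathGF n h))
pathGF-D-rec n h = begin
  pathGF-D (suc n) h
    ≈⟨ ∑-map-++-map (qPow ∘ pathMaj ∘ D) U D (allPaths n h) (allPaths n (2 + h)) ⟩
  ∑ (λ p → qPow (suc n + pathMaj p)) (allPaths n h) ⊕ pathGF-D n (suc h)
    ≈⟨ +P-cong (∑-qPow-+ (suc n) pathMaj (allPaths n h)) ≋-refl ⟩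
  qPow (suc n) ⊗ pathGF n h ⊕ pathGF-D n (suc h)
    ≈⟨ rearrange (qPow (suc n)) (pathGF n h) (pathGF-D n (suc h)) ⟩
  (pathGF n h ⊕ pathGF-D n (suc h)) ⊕ (⊖ (1-q^ (suc n) ⊗ pathGF n h))
    ≈⟨ +P-cong (∑-map-++-map (qPow ∘ pathMaj) U D (allPaths n h) (allPaths n (2 + h))) ≋-refl ⟨
  pathGF (suc n) (suc h) ⊕ (⊖ (1-q^ (suc n) ⊗ pathGF n h)) ∎
  where
  open ≋-Reasoning
  rearrange : ∀ x y z → x ⊗ y ⊕ z ≋ (y ⊕ z) ⊕ (⊖ ((1# ⊕ (⊖ x)) ⊗ y))
  rearrange = solvePoly polyACR

pathGF-rec-suc : ∀ n h → pathGF (2 + n) (suc h) ≋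
  (pathGF (suc n) h ⊕ pathGF (suc n) (2 + h)) ⊕ (⊖ (1-q^ (suc n) ⊗ pathGF n (suc h)))
pathGF-rec-suc n h = ≋-trans
  (∑-map-++-map (qPow ∘ pathMaj) U D (allPaths (suc n) h) (allPaths (suc n) (2 + h)))
  (≋-trans (+P-cong (≋-refl {pathGF (suc n) h}) (pathGF-D-rec n (suc h)))
  (≋-sym (+P-assoc (pathGF (suc n) h) (pathGF (suc n) (2 + h)) _)))

pathGF-rec-zero : ∀ n → pathGF (2 + n) 0 ≋
  (pathGF (suc n) 0 ⊕ pathGF (suc n) 1) ⊕ (⊖ (1-q^ (suc n) ⊗ pathGF n 0))
pathGF-rec-zero n = ≋-trans
  (∑-map-++-map (qPow ∘ pathMaj) F D (allPaths (suc n) 0) (allPaths (suc n) 1))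
  (≋-trans (+P-cong (≋-refl {pathGF (suc n) 0}) (pathGF-D-rec n 0))
  (≋-sym (+P-assoc (pathGF (suc n) 0) (pathGF (suc n) 1) _)))

allPaths-empty : ∀ {n h} → n < h → allPaths n h ≡ []
allPaths-empty {zero}  {suc h} _         = refl
allPaths-empty {suc n} {suc h} (s≤s n<h)
  rewrite allPaths-empty n<h | allPaths-empty (m<n⇒m<1+n (m<n⇒m<1+n n<h)) = refl

-- A path to height h that contains a D has at least h + 2 letters, so the only path here consists
-- of `e` flat steps followed by h letters U.
pathGF-noD : ∀ h e → e ≤ 1 → pathGF (h + e) h ≋ oneP
pathGF-noD zero    _ z≤n       = +P-identityʳ oneP
pathGF-noD zero    _ (s≤s z≤n) = +P-identityʳ oneP
pathGF-noD (suc h) e e≤1       = begin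
  pathGF (suc (h + e)) (suc h)
    ≈⟨ ∑-map-++-map (qPow ∘ pathMaj) U D (allPaths (h + e) h) (allPaths (h + e) (2 + h)) ⟩
  pathGF (h + e) h ⊕ pathGF-D (h + e) (suc h)
    ≡⟨ cong (λ ps → pathGF (h + e) h ⊕ ∑ (qPow ∘ pathMaj ∘ D) ps) (allPaths-empty h+e<2+h) ⟩
  pathGF (h + e) h ⊕ []
    ≈⟨ +P-identityʳ (pathGF (h + e) h) ⟩
  pathGF (h + e) h
    ≈⟨ pathGF-noD h e e≤1 ⟩
  oneP ∎
  where
  open ≋-Reasoning
  h+e<2+h : h + e < 2 + h
  h+e<2+h = s≤s (≤-trans (+-monoʳ-≤ h e≤1) (≤-reflexive (+-comm h 1)))

rec-cong : ∀ {p p′ r r′ s s′} x → p ≋ p′ → r ≋ r′ → s ≋ s′ → (p ⊕ r) ⊕ (⊖ (x ⊗ s)) ≋ (p′ ⊕ r′) ⊕ (⊖ (x ⊗ s′))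
rec-cong x e f g = +P-cong (+P-cong e f) (-P-cong (*P-congˡ x g))

-- The length is k + b, and k and e are the quotient and the remainder of (length - h) by 2.
pathGF≋gauss : ∀ k b h e → e ≤ 1 → b ≡ k + (h + e) → pathGF (k + b) h ≋ gauss k b
pathGF≋gauss zero    _       h       e e≤1       refl = pathGF-noD h e e≤1
pathGF≋gauss (suc k) (suc b) (suc h) e e≤1       eq   = begin
  pathGF (suc (k + suc b)) (suc h)
    ≡⟨ cong (λ n → pathGF (suc n) (suc h)) (+-suc k b) ⟩
  pathGF (2 + (k + b)) (suc h)
    ≈⟨ pathGF-rec-suc (k + b) h ⟩
  (pathGF (suc (k + b)) h ⊕ pathGF (suc (k + b)) (2 + h)) ⊕ (⊖ (1-q^ (suc (k + b)) ⊗ pathGF (k + b) (suc h)))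
    ≈⟨ rec-cong (1-q^ (suc (k + b)))
         -- Dropping a final U keeps length minus height, hence the quotient `suc k`. Dropping a
         -- final D, or two letters at equal height, lowers the difference by 2 and the quotient to
         -- `k`. The remainder `e` stays.
         (pathGF≋gauss (suc k) b h e e≤1 (trans b≡ (+-suc k (h + e))))
         (≋-trans (≋-reflexive (cong (λ n → pathGF n (2 + h)) (sym (+-suc k b))))
                  (pathGF≋gauss k (suc b) (2 + h) e e≤1 (trans (cong suc b≡) (sym (+-suc k _)))))
         (pathGF≋gauss k b (suc h) e e≤1 b≡) ⟩
  (gauss (suc k) b ⊕ gauss k (suc b)) ⊕ (⊖ (1-q^ (suc (k + b)) ⊗ gauss k b))
    ≈⟨ gauss-rec k b ⟨
  gauss (suc k) (suc b) ∎
  where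
  open ≋-Reasoning
  b≡ : b ≡ k + (suc h + e)
  b≡ = suc-injective eq
pathGF≋gauss (suc k) (suc b) zero    e e≤1       eq   = begin
  pathGF (suc (k + suc b)) 0
    ≡⟨ cong (λ n → pathGF (suc n) 0) (+-suc k b) ⟩
  pathGF (2 + (k + b)) 0
    ≈⟨ pathGF-rec-zero (k + b) ⟩
  (pathGF (suc (k + b)) 0 ⊕ pathGF (suc (k + b)) 1) ⊕ (⊖ (1-q^ (suc (k + b)) ⊗ pathGF (k + b) 0))
    ≈⟨ rec-cong (1-q^ (suc (k + b)))
         (flat e≤1 b≡)
         (≋-trans (≋-reflexive (cong (λ n → pathGF n 1) (sym (+-suc k b))))
                  (pathGF≋gauss k (suc b) 1 e e≤1 (trans (cong suc b≡) (sym (+-suc k _)))))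
         (pathGF≋gauss k b 0 e e≤1 b≡) ⟩
  (gauss (suc k) b ⊕ gauss k (suc b)) ⊕ (⊖ (1-q^ (suc (k + b)) ⊗ gauss k b))
    ≈⟨ gauss-rec k b ⟨
  gauss (suc k) (suc b) ∎
  where
  open ≋-Reasoning
  b≡ : b ≡ k + e
  b≡ = suc-injective eq
  -- Removing a flat step changes the parity of the length; for e = 0 the symmetry of the q-binomial compensates for this.
  flat : ∀ {e} → e ≤ 1 → b ≡ k + e → pathGF (suc (k + b)) 0 ≋ gauss (suc k) b
  flat z≤n b≡k+0 = begin
    pathGF (suc (k + b)) 0   ≡⟨ cong (λ n → pathGF n 0) (+-suc k b) ⟨
    pathGF (k + suc b) 0     ≈⟨ pathGF≋gauss k (suc b) 0 1 (s≤s z≤n) (trans (cong suc b≡k) (+-comm 1 k)) ⟩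
    gauss k (suc b)            ≡⟨ cong (λ m → gauss k (suc m)) b≡k ⟩
    gauss k (suc k)            ≈⟨ gauss-sym k (suc k) ⟩
    gauss (suc k) k            ≡⟨ cong (gauss (suc k)) b≡k ⟨
    gauss (suc k) b            ∎
    where
    b≡k : b ≡ k
    b≡k = trans b≡k+0 (+-identityʳ k)
  flat (s≤s z≤n) b≡k+1 = pathGF≋gauss (suc k) b 0 0 z≤n (trans b≡k+1 (+-suc k 0))

-- Paths as involutions of ℕ

-- The increasing injection that misses n.
up : ℕ → ℕ → ℕ
up n x with x <? n
... | yes _ = x
... | no  _ = suc x

up-< : ∀ {n x} → x < n → up n x ≡ x
up-< {n} {x} x<n with x <? n
... | yes _   = refl
... | no  x≮n = contradiction x<n x≮n

up-≥ : ∀ {n x} → n ≤ x → up n x ≡ suc x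
up-≥ {n} {x} n≤x with x <? n
... | yes x<n = contradiction x<n (≤⇒≯ n≤x)
... | no  _   = refl

x≤up : ∀ n x → x ≤ up n x
x≤up n x with x <? n
... | yes _ = ≤-refl
... | no  _ = n≤1+n x

up≤1+x : ∀ n x → up n x ≤ suc x
up≤1+x n x with x <? n
... | yes _ = n≤1+n x
... | no  _ = ≤-refl

up≢ : ∀ n x → up n x ≢ n
up≢ n x eq with x <? n
... | yes x<n = <⇒≢ x<n eq
... | no  x≮n = x≮n (≤-reflexive eq)

up-mono-< : ∀ n {x y} → x < y → up n x < up n y
up-mono-< n {x} {y} x<y with x <? n
... | yes _   = <-≤-trans x<y (x≤up n y)
... | no  x≮n = subst (suc x <_) (sym (up-≥ (≤-trans (≮⇒≥ x≮n) (<⇒≤ x<y)))) (s≤s x<y)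

up-cancel-< : ∀ n {x y} → up n x < up n y → x < y
up-cancel-< n {x} {y} ux<uy with <-cmp x y
... | tri< x<y _ _  = x<y
... | tri≈ _ refl _ = contradiction ux<uy (<-irrefl refl)
... | tri> _ _ y<x  = contradiction ux<uy (<⇒≯ (up-mono-< n y<x))

up-injective : ∀ n {x y} → up n x ≡ up n y → x ≡ y
up-injective n {x} {y} eq with <-cmp x y
... | tri< x<y _ _ = contradiction eq (<⇒≢ (up-mono-< n x<y))
... | tri≈ _ x≡y _ = x≡y
... | tri> _ _ y<x = contradiction (sym eq) (<⇒≢ (up-mono-< n y<x))

n<up⇒n≤ : ∀ {n x} → n < up n x → n ≤ x
n<up⇒n≤ {n} {x} n<ux = s≤s⁻¹ (<-≤-trans n<ux (up≤1+x n x))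

-- Inverse of `up n` away from `n`; the value at `n` is arbitrary and excluded in `up-down`.
down : ℕ → ℕ → ℕ
down n y with y <? n
... | yes _ = y
... | no  _ = pred y

up-down : ∀ {n y} → y ≢ n → up n (down n y) ≡ y
up-down {n} {y} y≢n with y <? n
... | yes y<n = up-< y<n
up-down {n} {zero}  y≢n | no y≮n = contradiction (sym (n≤0⇒n≡0 (≮⇒≥ y≮n))) y≢n
up-down {n} {suc y} y≢n | no y≮n = up-≥ (s≤s⁻¹ (≤∧≢⇒< (≮⇒≥ y≮n) (y≢n ∘ sym)))

down-up : ∀ n x → down n (up n x) ≡ x
down-up n x = up-injective n (up-down (up≢ n x))

-- Conjugating by `up n` frees the point `n`; the point `n + h`, fixed by π in all uses, moves to
-- `suc (n + h)` and becomes the partner of `n`. The closers of older open 2-cycles land on n + 1,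
-- ..., n + h, before the new one, so that the earliest U is closed first.
insert : ℕ → ℕ → (ℕ → ℕ) → ℕ → ℕ
insert n h π y with y ≟ n | y ≟ suc (n + h)
... | yes _ | _     = suc (n + h)
... | no  _ | yes _ = n
... | no  _ | no  _ = up n (π (down n y))

module _ (n h : ℕ) where

  data View : ℕ → Set where
    new   : View n
    last  : View (suc (n + h))
    shift : ∀ {x} → x ≢ n + h → View (up n x)

  up-last : up n (n + h) ≡ suc (n + h)
  up-last = up-≥ (m≤m+n n h)

  view : ∀ y → View y
  view y with y ≟ n | y ≟ suc (n + h)
  ... | yes refl | _        = new
  ... | no  _    | yes refl = last
  ... | no  y≢n  | no  y≢l  = subst View (up-down y≢n)
    (shift λ eq → y≢l (trans (sym (up-down y≢n)) (trans (cong (up n) eq) up-last)))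

  module _ (π : ℕ → ℕ) where

    insert-new : insert n h π n ≡ suc (n + h)
    insert-new with n ≟ n | n ≟ suc (n + h)
    ... | yes _   | _ = refl
    ... | no  n≢n | _ = contradiction refl n≢n

    insert-last : insert n h π (suc (n + h)) ≡ n
    insert-last with suc (n + h) ≟ n | suc (n + h) ≟ suc (n + h)
    ... | yes l≡n | _       = contradiction (sym l≡n) (<⇒≢ (s≤s (m≤m+n n h)))
    ... | no  _   | yes _   = refl
    ... | no  _   | no  l≢l = contradiction refl l≢l

    insert-up : ∀ {x} → x ≢ n + h → insert n h π (up n x) ≡ up n (π x)
    insert-up {x} x≢l with up n x ≟ n | up n x ≟ suc (n + h)
    ... | yes eq | _      = contradiction eq (up≢ n x)
    ... | no  _  | yes eq = contradiction (up-injective n (trans eq (sym up-last))) x≢l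
    ... | no  _  | no  _  = cong (up n ∘ π) (down-up n x)

  insert-cong : ∀ {π ρ} → π ≗ ρ → insert n h π ≗ insert n h ρ
  insert-cong {π} {ρ} π≗ρ y with view y
  ... | new       = trans (insert-new π) (sym (insert-new ρ))
  ... | last      = trans (insert-last π) (sym (insert-last ρ))
  ... | shift x≢l = trans (insert-up π x≢l) (trans (cong (up n) (π≗ρ _)) (sym (insert-up ρ x≢l)))

  insert-injective : ∀ {π ρ} → π (n + h) ≡ n + h → ρ (n + h) ≡ n + h → insert n h π ≗ insert n h ρ → π ≗ ρ
  insert-injective {π} {ρ} πl ρl eq x with x ≟ n + h
  ... | yes refl = trans πl (sym ρl)
  ... | no  x≢l  = up-injective n (trans (sym (insert-up π x≢l)) (trans (eq (up n x)) (insert-up ρ x≢l)))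

-- Satisfied, up to pointwise equality, exactly by the functions `decode p` with `p : Path n h`:
-- `pending` makes n, ..., n + h - 1 the closers of the h open 2-cycles, whose openers lie below n.
-- For h = 0 these are the 321-avoiding involutions of n points, extended by the identity.
record Partial (n h : ℕ) (π : ℕ → ℕ) : Set where
  field
    invol     : ∀ x → π (π x) ≡ x
    beyond    : ∀ {x} → n + h ≤ x → π x ≡ x
    pending   : ∀ {x} → n ≤ x → x < n + h → π x < n
    -- for an involution, equivalent to avoiding 321
    inversion : ∀ {x y} → x < y → π y < π x → x < π x × π y < y

  injective : ∀ {x y} → π x ≡ π y → x ≡ y
  injective {x} {y} eq = trans (sym (invol x)) (trans (cong π eq) (invol y))

  swap : ∀ {x y} → π x ≡ y → π y ≡ x
  swap {x} refl = invol x

  bounded : ∀ {x} → x < n + h → π x < n + h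
  bounded {x} x<l with π x <? n + h
  ... | yes πx<l = πx<l
  ... | no  πx≮l = contradiction x<l (≤⇒≯ (subst (n + h ≤_) (injective (beyond (≮⇒≥ πx≮l))) (≮⇒≥ πx≮l)))

module _ {n h π} (P : Partial n h π) where
  open Partial P

  private
    l = n + h
    π′ = insert n h π

    n≤l : n ≤ l
    n≤l = m≤m+n n h

    πl : π l ≡ l
    πl = beyond ≤-refl

    insert-invol : ∀ y → π′ (π′ y) ≡ y
    insert-invol y with view n h y
    ... | new       = trans (cong π′ (insert-new n h π)) (insert-last n h π)
    ... | last      = trans (cong π′ (insert-last n h π)) (insert-new n h π)
    ... | shift {x} x≢l = trans (cong π′ (insert-up n h π x≢l))
      (trans (insert-up n h π (λ eq → x≢l (trans (sym (swap eq)) πl))) (cong (up n) (invol x)))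

    insert-beyond : ∀ {y} → suc n + suc h ≤ y → π′ y ≡ y
    insert-beyond {y} l≤y rewrite +-suc n h with view n h y
    ... | new       = contradiction (≤-trans (≤-trans (n≤1+n _) l≤y) n≤l) (<-irrefl refl)
    ... | last      = contradiction l≤y (<-irrefl refl)
    ... | shift {x} x≢l = trans (insert-up n h π x≢l)
      (cong (up n) (beyond (<⇒≤ (s≤s⁻¹ (≤-trans l≤y (up≤1+x n x))))))

    insert-pending : ∀ {y} → suc n ≤ y → y < suc n + suc h → π′ y < suc n
    insert-pending {y} n<y y<l rewrite +-suc n h with view n h y
    ... | new       = contradiction n<y (<-irrefl refl)
    ... | last      = s≤s (≤-reflexive (insert-last n h π))
    ... | shift {x} x≢l = subst (_< suc n) (sym (trans (insert-up n h π x≢l) (up-< πx<n))) (m<n⇒m<1+n πx<n)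
      where
      n≤x : n ≤ x
      n≤x = n<up⇒n≤ n<y
      πx<n : π x < n
      πx<n = pending n≤x (≤∧≢⇒< (s≤s⁻¹ (s≤s⁻¹ (subst (_< suc (suc l)) (up-≥ n≤x) y<l))) x≢l)

    -- The upper end `suc l` of the new cycle lies beyond all other moved points. So an inversion of
    -- `new` with an old point has a pending closer on its right, one of `last` with an old point
    -- has the opener of a pending cycle on its left, and inversions between old points come from π.
    insert-inversion : ∀ {x y} → x < y → π′ y < π′ x → x < π′ x × π′ y < y
    insert-inversion {x} {y} x<y inv with view n h x | view n h y
    ... | new | new  = contradiction x<y (<-irrefl refl)
    ... | new | last rewrite insert-new n h π | insert-last n h π = s≤s n≤l , s≤s n≤l
    ... | new | shift {y} y≢l rewrite insert-new n h π | insert-up n h π y≢l with y <? l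
    ...   | yes y<l = s≤s n≤l , subst (_< up n y) (sym (up-< πy<n)) (<-trans πy<n x<y)
      where
      πy<n : π y < n
      πy<n = pending (n<up⇒n≤ x<y) y<l
    ...   | no y≮l = contradiction (≤-<-trans (x≤up n (π y)) inv)
      (≤⇒≯ (subst (suc l ≤_) (sym (beyond (≮⇒≥ y≮l))) (≤∧≢⇒< (≮⇒≥ y≮l) (y≢l ∘ sym))))
    insert-inversion x<y inv | last | new  = contradiction (<-trans (s≤s n≤l) x<y) (<-irrefl refl)
    insert-inversion x<y inv | last | last = contradiction x<y (<-irrefl refl)
    insert-inversion x<y inv | last | shift {y} y≢l rewrite insert-last n h π | insert-up n h π y≢l =
      contradiction (<-trans (≤-<-trans n≤l (<-trans ≤-refl x<y)) (subst (λ z → up n z < n) (beyond l≤y) inv))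
                    (<-irrefl refl)
      where
      l≤y : l ≤ y
      l≤y = <⇒≤ (s≤s⁻¹ (≤-trans x<y (up≤1+x n y)))
    insert-inversion x<y inv | shift {x} x≢l | new rewrite insert-new n h π | insert-up n h π x≢l =
      contradiction (bounded (<-≤-trans (≤-<-trans (x≤up n x) x<y) n≤l))
                    (≤⇒≯ (<⇒≤ (s≤s⁻¹ (≤-trans inv (up≤1+x n (π x))))))
    insert-inversion x<y inv | shift {x} x≢l | last rewrite insert-last n h π | insert-up n h π x≢l with <-≤-connex x n
    ... | inj₁ x<n = up-mono-< n (<-≤-trans x<n (n<up⇒n≤ inv)) , s≤s n≤l
    ... | inj₂ n≤x = contradiction (n<up⇒n≤ inv)
      (<⇒≱ (pending n≤x (s≤s⁻¹ (subst (_< suc l) (up-≥ n≤x) x<y))))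
    insert-inversion x<y inv | shift {x} x≢l | shift {y} y≢l rewrite insert-up n h π x≢l | insert-up n h π y≢l =
      let x<πx , πy<y = inversion (up-cancel-< n x<y) (up-cancel-< n inv)
      in up-mono-< n x<πx , up-mono-< n πy<y

  insert-partial : Partial (suc n) (suc h) π′
  insert-partial = record
    { invol = insert-invol ; beyond = insert-beyond ; pending = insert-pending ; inversion = insert-inversion }

close-partial : ∀ {n h π} → Partial n (suc h) π → Partial (suc n) h π
close-partial {n} {h} P = record
  { invol     = invol
  ; beyond    = λ l≤x → beyond (≤-trans (≤-reflexive (+-suc n h)) l≤x)
  ; pending   = λ n<x x<l → m<n⇒m<1+n (pending (<⇒≤ n<x) (<-≤-trans x<l (≤-reflexive (sym (+-suc n h)))))
  ; inversion = inversion
  }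
  where open Partial P

fix-partial : ∀ {n π} → Partial n 0 π → Partial (suc n) 0 π
fix-partial P = record
  { invol     = invol
  ; beyond    = λ l≤x → beyond (≤-trans (n≤1+n _) l≤x)
  ; pending   = λ n<x x<l → contradiction (<-≤-trans x<l (≤-trans (≤-reflexive (+-identityʳ _)) n<x)) (<-irrefl refl)
  ; inversion = inversion
  }
  where open Partial P

-- The h unmatched U's of a path of length n are matched with n, …, n + h - 1, as if the path continued with h steps D
-- and was followed by fixed points.  Hence the involution changes only when a U is appended.
decode : ∀ {n h} → Path n h → ℕ → ℕ
decode ε             = λ x → x
decode (F p)         = decode p
decode (U {n} {h} p) = insert n h (decode p)
decode (D p)         = decode p

decode-partial : ∀ {n h} (p : Path n h) → Partial n h (decode p)
decode-partial ε     = record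
  { invol = λ _ → refl ; beyond = λ _ → refl ; pending = λ _ () ; inversion = λ x<y y<x → contradiction y<x (<⇒≯ x<y) }
decode-partial (F p) = fix-partial (decode-partial p)
decode-partial (U p) = insert-partial (decode-partial p)
decode-partial (D p) = close-partial (decode-partial p)

-- This and the next two lemmas recover the last letter from the comparison of the value at `n` with
-- `n`.
decode-F : ∀ {n} (p : Path n 0) → decode p n ≡ n
decode-F p = Partial.beyond (decode-partial p) (≤-reflexive (+-identityʳ _))

decode-U : ∀ {n h} (p : Path n h) → n < decode (U p) n
decode-U {n} {h} p = subst (n <_) (sym (insert-new n h (decode p))) (s≤s (m≤m+n n h))

decode-D : ∀ {n h} (p : Path n (suc h)) → decode p n < n
decode-D {n} p = Partial.pending (decode-partial p) ≤-refl (m<m+n n (s≤s z≤n))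

decode-injective : ∀ {n h} (p q : Path n h) → decode p ≗ decode q → p ≡ q
decode-injective ε     ε     eq = refl
decode-injective (F p) (F q) eq = cong F (decode-injective p q eq)
decode-injective (F p) (D q) eq = contradiction (trans (sym (eq _)) (decode-F p)) (<⇒≢ (decode-D q))
decode-injective (D p) (F q) eq = contradiction (trans (eq _) (decode-F q)) (<⇒≢ (decode-D p))
decode-injective (D p) (D q) eq = cong D (decode-injective p q eq)
decode-injective (U p) (D q) eq = contradiction (decode-U p) (<⇒≯ (subst (_< _) (sym (eq _)) (decode-D q)))
decode-injective (D p) (U q) eq = contradiction (decode-U q) (<⇒≯ (subst (_< _) (eq _) (decode-D p)))
decode-injective (U {n} {h} p) (U q) eq = cong U (decode-injective p q
  (insert-injective n h (Partial.beyond (decode-partial p) ≤-refl) (Partial.beyond (decode-partial q) ≤-refl) eq))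

-- Recovering the path from the involution

delete : ℕ → ℕ → (ℕ → ℕ) → ℕ → ℕ
delete n h σ x with x ≟ n + h
-- `up n` sends this point to the partner of `n`, whose value `n` is not in the range of `up n`; it
-- becomes the fixed point that `beyond` demands.
... | yes _ = n + h
... | no  _ = down n (σ (up n x))

module _ {n h σ} (P : Partial (suc n) (suc h) σ) (σn≡ : σ n ≡ suc (n + h)) where
  open Partial P

  private
    l = n + h
    σ′ = delete n h σ

    σl≡ : σ (suc l) ≡ n
    σl≡ = swap σn≡

    delete-last : σ′ l ≡ l
    delete-last with l ≟ l
    ... | yes _   = refl
    ... | no  l≢l = contradiction refl l≢l

    delete-up : ∀ {x} → x ≢ l → up n (σ′ x) ≡ σ (up n x)
    delete-up {x} x≢l with x ≟ l
    ... | yes eq = contradiction eq x≢l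
    ... | no  _  = up-down λ eq → x≢l (up-injective n
      (trans (sym (swap eq)) (trans σn≡ (sym (up-last n h)))))

    delete≢l : ∀ {x} → x ≢ l → σ′ x ≢ l
    delete≢l {x} x≢l eq = up≢ n x (begin
      up n x           ≡⟨ swap refl ⟨
      σ (σ (up n x))   ≡⟨ cong σ (delete-up x≢l) ⟨
      σ (up n (σ′ x))  ≡⟨ cong (σ ∘ up n) eq ⟩
      σ (up n l)       ≡⟨ cong σ (up-last n h) ⟩
      σ (suc l)        ≡⟨ σl≡ ⟩
      n                ∎)
      where open ≡-Reasoning

    delete-invol : ∀ x → σ′ (σ′ x) ≡ x
    delete-invol x with toSum (x ≟ l)
    ... | inj₁ refl = trans (cong σ′ delete-last) delete-last
    ... | inj₂ x≢l  = up-injective n (begin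
      up n (σ′ (σ′ x))  ≡⟨ delete-up (delete≢l x≢l) ⟩
      σ (up n (σ′ x))   ≡⟨ cong σ (delete-up x≢l) ⟩
      σ (σ (up n x))    ≡⟨ invol (up n x) ⟩
      up n x            ∎)
      where open ≡-Reasoning

    delete-beyond : ∀ {x} → l ≤ x → σ′ x ≡ x
    delete-beyond {x} l≤x with toSum (x ≟ l)
    ... | inj₁ refl = delete-last
    ... | inj₂ x≢l  = up-injective n (trans (delete-up x≢l) (beyond (begin
      suc (n + suc h)  ≡⟨ cong suc (+-suc n h) ⟩
      suc (suc l)      ≤⟨ s≤s (≤∧≢⇒< l≤x (x≢l ∘ sym)) ⟩
      suc x            ≡⟨ up-≥ (≤-trans (m≤m+n n h) l≤x) ⟨
      up n x           ∎)))
      where open ≤-Reasoning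

    delete-pending : ∀ {x} → n ≤ x → x < l → σ′ x < n
    delete-pending {x} n≤x x<l = ≤-<-trans (x≤up n (σ′ x)) (≤∧≢⇒< (s≤s⁻¹ (begin-strict
      up n (σ′ x)  ≡⟨ delete-up (<⇒≢ x<l) ⟩
      σ (up n x)   ≡⟨ cong σ (up-≥ n≤x) ⟩
      σ (suc x)    <⟨ pending (s≤s n≤x) (s≤s (<-≤-trans x<l (+-monoʳ-≤ n (n≤1+n h)))) ⟩
      suc n        ∎)) (up≢ n (σ′ x)))
      where open ≤-Reasoning

    delete-inversion : ∀ {x y} → x < y → σ′ y < σ′ x → x < σ′ x × σ′ y < y
    delete-inversion {x} {y} x<y inv with toSum (x ≟ l) | toSum (y ≟ l)
    ... | inj₁ refl | _         = contradiction (subst₂ _<_ (delete-beyond (<⇒≤ x<y)) delete-last inv) (<⇒≯ x<y)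
    ... | inj₂ x≢l  | inj₁ refl = contradiction x<y (<⇒≯ (subst (l <_) σ′x≡x l<σ′x))
      where
      l<σ′x : l < σ′ x
      l<σ′x = subst (_< σ′ x) delete-last inv
      σ′x≡x : σ′ x ≡ x
      σ′x≡x = trans (sym (delete-beyond (<⇒≤ l<σ′x))) (delete-invol x)
    ... | inj₂ x≢l  | inj₂ y≢l  =
      let x<σx , σy<y = inversion (up-mono-< n x<y) (subst₂ _<_ (delete-up y≢l) (delete-up x≢l) (up-mono-< n inv))
      in  up-cancel-< n (subst (up n x <_) (sym (delete-up x≢l)) x<σx)
        , up-cancel-< n (subst (_< up n y) (sym (delete-up y≢l)) σy<y)

  delete-partial : Partial n h σ′
  delete-partial = record
    { invol = delete-invol ; beyond = delete-beyond ; pending = delete-pending ; inversion = delete-inversion }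

  insert-delete : insert n h σ′ ≗ σ
  insert-delete y with view n h y
  ... | new       = trans (insert-new n h σ′) (sym σn≡)
  ... | last      = trans (insert-last n h σ′) (sym σl≡)
  ... | shift x≢l = trans (insert-up n h σ′ x≢l) (delete-up x≢l)

-- If a 2-cycle were still open, the one closed at `suc n` would pass over the fixed point n, and
-- the inversion of its opener with n would force σ n < n.
fix-height : ∀ {n h σ} → Partial (suc n) h σ → σ n ≡ n → h ≡ 0
fix-height {h = zero}              P σn≡n = refl
fix-height {n = n} {h = suc h} {σ} P σn≡n =
  contradiction σn≡n (<⇒≢ (proj₂ (inversion a<n (subst₂ _<_ (sym σn≡n) (sym (invol (suc n))) ≤-refl))))
  where
  open Partial P
  a<n : σ (suc n) < n
  a<n = ≤∧≢⇒< (s≤s⁻¹ (pending ≤-refl (m<m+n (suc n) (s≤s z≤n))))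
              (λ eq → 1+n≢n (sym (trans (sym σn≡n) (swap eq))))

-- The latest opener must take the last pending closer `l`: otherwise the cycle closed at `l` would
-- enclose that of n, and the inversion of its opener with n would force σ n < n.
open-height : ∀ {n h σ} → Partial (suc n) h σ → n < σ n → ∃ λ k → h ≡ suc k × σ n ≡ suc (n + k)
open-height {n} {zero} {σ} P n<σn =
  contradiction (injective (beyond (≤-trans (≤-reflexive (+-identityʳ (suc n))) n<σn))) (<⇒≢ n<σn ∘ sym)
  where open Partial P
open-height {n} {suc h} {σ} P n<σn = h , refl , ≤∧≮⇒≡ σn≤l λ σn<l →
  <⇒≯ n<σn (proj₂ (inversion (a<n σn<l) (subst (σ n <_) (sym (invol l)) σn<l)))
  where
  open Partial P
  l = suc (n + h)
  l<1+n+1+h : l < suc n + suc h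
  l<1+n+1+h = s≤s (≤-reflexive (sym (+-suc n h)))
  σn≤l : σ n ≤ l
  σn≤l = s≤s⁻¹ (<-≤-trans (bounded (s≤s (m≤m+n n (suc h)))) (s≤s (≤-reflexive (+-suc n h))))
  a<n : σ n < l → σ l < n
  a<n σn<l = ≤∧≢⇒< (s≤s⁻¹ (pending (s≤s (m≤m+n n h)) l<1+n+1+h)) (λ eq → <⇒≢ σn<l (swap eq))

decode-surjective : ∀ n {h σ} → Partial n h σ → Σ (Path n h) λ p → decode p ≗ σ
decode-surjective zero    {zero}  P = ε , λ x → sym (Partial.beyond P z≤n)
decode-surjective zero    {suc h} P = contradiction (Partial.pending P z≤n (s≤s z≤n)) λ ()
decode-surjective (suc n) {h} {σ} P with <-cmp (σ n) n
... | tri< σn<n _ _ = let p , eq = decode-surjective n open-partial in D p , eq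
  where
  open Partial P
  open-partial : Partial n (suc h) σ
  open-partial = record
    { invol     = invol
    ; beyond    = λ l≤x → beyond (≤-trans (≤-reflexive (sym (+-suc n h))) l≤x)
    ; pending   = pending′
    ; inversion = inversion
    }
    where
    pending′ : ∀ {x} → n ≤ x → x < n + suc h → σ x < n
    pending′ {x} n≤x x<l with toSum (x ≟ n)
    ... | inj₁ refl = σn<n
    ... | inj₂ x≢n  = ≤∧≢⇒<
      (s≤s⁻¹ (pending (≤∧≢⇒< n≤x (x≢n ∘ sym)) (<-≤-trans x<l (≤-reflexive (+-suc n h)))))
      (λ eq → <⇒≱ σn<n (≤-trans n≤x (≤-reflexive (sym (swap eq)))))
... | tri≈ _ σn≡n _ with refl ← fix-height P σn≡n =
  let p , eq = decode-surjective n unfix-partial in F p , eq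
  where
  open Partial P
  unfix-partial : Partial n 0 σ
  unfix-partial = record
    { invol     = invol
    ; beyond    = beyond′
    ; pending   = λ n≤x x<l → contradiction (<-≤-trans x<l (≤-trans (≤-reflexive (+-identityʳ n)) n≤x)) (<-irrefl refl)
    ; inversion = inversion
    }
    where
    beyond′ : ∀ {x} → n + 0 ≤ x → σ x ≡ x
    beyond′ {x} n≤x with toSum (x ≟ n)
    ... | inj₁ refl = σn≡n
    ... | inj₂ x≢n  = beyond (≤∧≢⇒< n≤x λ eq → x≢n (trans (sym eq) (+-identityʳ n)))
... | tri> _ _ n<σn with k , refl , σn≡ ← open-height P n<σn =
  let p , eq = decode-surjective n (delete-partial P σn≡)
  in  U p , λ y → trans (insert-cong n k eq y) (insert-delete P σn≡ y)

-- Descents and peaks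

descent : (ℕ → ℕ) → ℕ → ℕ
descent π zero    = 0
descent π (suc i) = if π (suc i) <ᵇ π i then suc i else 0

-- Descents are indexed by their right end, so that a new last letter adds one term; the left end i,
-- counted from 0, is position `suc i` in `maj`.
descents : (ℕ → ℕ) → ℕ → ℕ
descents π zero    = 0
descents π (suc n) = descent π n + descents π n

<ᵇ-true : ∀ {m n} → m < n → (m <ᵇ n) ≡ true
<ᵇ-true m<n = Equivalence.to T-≡ (<⇒<ᵇ m<n)

<ᵇ-false : ∀ {m n} → ¬ (m < n) → (m <ᵇ n) ≡ false
<ᵇ-false {m} {n} m≮n with m <ᵇ n in eq
... | true  = contradiction (<ᵇ⇒< m n (Equivalence.from T-≡ eq)) m≮n
... | false = refl

up-<ᵇ : ∀ n x y → (up n x <ᵇ up n y) ≡ (x <ᵇ y)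
up-<ᵇ n x y with toSum (x <? y)
... | inj₁ x<y = trans (<ᵇ-true (up-mono-< n x<y)) (sym (<ᵇ-true x<y))
... | inj₂ x≮y = trans (<ᵇ-false (x≮y ∘ up-cancel-< n)) (sym (<ᵇ-false x≮y))

descent-≮ : ∀ π {i} → ¬ (π (suc i) < π i) → descent π (suc i) ≡ 0
descent-≮ π {i} ≮ = cong (if_then suc i else 0) (<ᵇ-false ≮)

descent-nonD : ∀ {n h π} → Partial n h π → ∀ i → i ≤ π i → descent π i ≡ 0
descent-nonD P zero    _    = refl
descent-nonD {π = π} P (suc i) i≤πi = descent-≮ π λ lt → <⇒≱ (proj₂ (Partial.inversion P ≤-refl lt)) i≤πi

-- After a U there is a descent, since the values at the two positions lie on either side of the
-- step between them. After a D there is none, since the left end of an inversion is a U.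
descent-D : ∀ {n h} (p : Path n (suc h)) → descent (decode p) n ≡ peak p
descent-D (U {n} {h} p) = cong (if_then suc n else 0)
  (<ᵇ-true (<-≤-trans (decode-D (U p)) (decode-U p)))
descent-D (D p) = descent-≮ (decode p) λ lt →
  <⇒≯ (decode-D p) (proj₁ (Partial.inversion (decode-partial p) ≤-refl lt))

-- Below `n` insertion only composes π with the increasing map `up n`, which preserves all
-- comparisons.
insert-descents : ∀ n h π {k} → k ≤ n → descents (insert n h π) k ≡ descents π k
insert-descents n h π {zero}        _   = refl
insert-descents n h π {suc zero}    _   = refl
insert-descents n h π {suc (suc i)} i<n = cong₂ _+_
  (cong (if_then suc i else 0)
    (trans (cong₂ _<ᵇ_ (insert-< i<n) (insert-< (<-trans ≤-refl i<n))) (up-<ᵇ n (π (suc i)) (π i))))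
  (insert-descents n h π (<⇒≤ i<n))
  where
  insert-< : ∀ {x} → x < n → insert n h π x ≡ up n (π x)
  insert-< x<n = trans (cong (insert n h π) (sym (up-< x<n))) (insert-up n h π (<⇒≢ (<-≤-trans x<n (m≤m+n n h))))

descents-decode : ∀ {n h} (p : Path n h) → descents (decode p) n ≡ pathMaj p
descents-decode ε             = refl
descents-decode (F p)         = cong₂ _+_
  (descent-nonD (decode-partial p) _ (≤-reflexive (sym (decode-F p)))) (descents-decode p)
descents-decode (U {n} {h} p) = cong₂ _+_
  (descent-nonD (decode-partial (U p)) n (<⇒≤ (decode-U p)))
  (trans (insert-descents n h (decode p) ≤-refl) (descents-decode p))
descents-decode (D p)         = cong₂ _+_ (descent-D p) (descents-decode p)

-- Paths as vectors

allPaths-complete : ∀ {n h} (p : Path n h) → p ∈ allPaths n h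
allPaths-complete ε     = here refl
allPaths-complete (F p) = ∈-++⁺ˡ (∈-map⁺ F (allPaths-complete p))
allPaths-complete (U p) = ∈-++⁺ˡ (∈-map⁺ U (allPaths-complete p))
allPaths-complete {suc n} {zero}  (D p) = ∈-++⁺ʳ (map F (allPaths n 0)) (∈-map⁺ D (allPaths-complete p))
allPaths-complete {suc n} {suc h} (D p) = ∈-++⁺ʳ (map U (allPaths n h)) (∈-map⁺ D (allPaths-complete p))

allPaths-unique : ∀ n h → Unique (allPaths n h)
allPaths-unique zero    zero    = [] ∷ []
allPaths-unique zero    (suc h) = []
allPaths-unique (suc n) zero    = Unique.++⁺
  (Unique.map⁺ (λ { refl → refl }) (allPaths-unique n 0))
  (Unique.map⁺ (λ { refl → refl }) (allPaths-unique n 1))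
  λ (∈F , ∈D) → case ∈-map⁻ F ∈F , ∈-map⁻ D ∈D of λ { ((_ , _ , refl) , (_ , _ , ())) }
allPaths-unique (suc n) (suc h) = Unique.++⁺
  (Unique.map⁺ (λ { refl → refl }) (allPaths-unique n h))
  (Unique.map⁺ (λ { refl → refl }) (allPaths-unique n (2 + h)))
  λ (∈U , ∈D) → case ∈-map⁻ U ∈U , ∈-map⁻ D ∈D of λ { ((_ , _ , refl) , (_ , _ , ())) }

concatMap-map : ∀ {A B C : Set} (f : A → B → C) xs ys →
                List.concatMap (λ x → map (f x) ys) xs ≡ cartesianProductWith f xs ys
concatMap-map f []       ys = refl
concatMap-map f (x ∷ xs) ys = cong (map (f x) ys ++_) (concatMap-map f xs ys)

allVecs-complete : ∀ {n m} (v : Vec (Fin n) m) → v ∈ allVecs n m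
allVecs-complete []      = here refl
allVecs-complete {n} {suc m} (x ∷ v) = subst (_ ∈_) (sym (concatMap-map _∷_ (allFin n) (allVecs n m)))
  (∈-cartesianProductWith⁺ _∷_ (∈-allFin x) (allVecs-complete v))

allVecs-unique : ∀ n m → Unique (allVecs n m)
allVecs-unique n zero    = [] ∷ []
allVecs-unique n (suc m) = subst Unique (sym (concatMap-map _∷_ (allFin n) (allVecs n m)))
  (Unique.cartesianProductWith⁺ _∷_ Vec.∷-injective (Unique.allFin⁺ n) (allVecs-unique n m))

-- The Boolean tests for involutions and for 321

T-not⁺ : ∀ {b} → ¬ T b → T (not b)
T-not⁺ {true}  ¬t = ¬t tt
T-not⁺ {false} _  = tt

T-not⁻ : ∀ {b} → T (not b) → ¬ T b
T-not⁻ {false} _ ()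

all-allFin⁺ : ∀ {n} {f : Fin n → Bool} → (∀ i → T (f i)) → T (all f (allFin n))
all-allFin⁺ {n} t = All.all⁻ _ (All.universal t (allFin n))

all-allFin⁻ : ∀ {n} {f : Fin n → Bool} → T (all f (allFin n)) → ∀ i → T (f i)
all-allFin⁻ {n} t i = All.lookup (All.all⁺ _ (allFin n) t) (∈-allFin i)

any-allFin⁺ : ∀ {n} {f : Fin n → Bool} i → T (f i) → T (any f (allFin n))
any-allFin⁺ i t = Any.any⁺ _ (lose (∈-allFin i) t)

any-allFin⁻ : ∀ {n} {f : Fin n → Bool} → T (any f (allFin n)) → ∃ λ i → T (f i)
any-allFin⁻ {n} t = Any.satisfied (Any.any⁻ _ (allFin n) t)

module _ {n} (π : Vec (Fin n) n) where

  private
    π⟨_⟩ : Fin n → ℕ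
    π⟨ i ⟩ = toℕ (lookup π i)

  contains321⁺ : ∀ {i j k} → toℕ i < toℕ j → toℕ j < toℕ k → π⟨ j ⟩ < π⟨ i ⟩ → π⟨ k ⟩ < π⟨ j ⟩ → T (contains321 π)
  contains321⁺ {i} {j} {k} i<j j<k πj<πi πk<πj = any-allFin⁺ i (any-allFin⁺ j (any-allFin⁺ k
    (Equivalence.from T-∧ (<⇒<ᵇ i<j , Equivalence.from T-∧ (<⇒<ᵇ j<k ,
      Equivalence.from T-∧ (<⇒<ᵇ πj<πi , <⇒<ᵇ πk<πj))))))

  contains321⁻ : T (contains321 π) → ∃ λ i → ∃ λ j → ∃ λ k →
                 toℕ i < toℕ j × toℕ j < toℕ k × π⟨ j ⟩ < π⟨ i ⟩ × π⟨ k ⟩ < π⟨ j ⟩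
  contains321⁻ t =
    let i , t₁     = any-allFin⁻ t
        j , t₂     = any-allFin⁻ t₁
        k , t₃     = any-allFin⁻ t₂
        i<j , t₄   = Equivalence.to T-∧ t₃
        j<k , t₅   = Equivalence.to T-∧ t₄
        ji  , kj   = Equivalence.to T-∧ t₅
    in i , j , k , <ᵇ⇒< _ _ i<j , <ᵇ⇒< _ _ j<k , <ᵇ⇒< _ _ ji , <ᵇ⇒< _ _ kj

  extend : ℕ → ℕ
  extend x with x <? n
  ... | yes x<n = π⟨ fromℕ< x<n ⟩
  ... | no  _   = x

  extend-toℕ : ∀ i → extend (toℕ i) ≡ π⟨ i ⟩
  extend-toℕ i with toℕ i <? n
  ... | yes i<n = cong π⟨_⟩ (Fin.fromℕ<-toℕ i i<n)
  ... | no  i≮n = contradiction (Fin.toℕ<n i) i≮n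

  extend-≥ : ∀ {x} → n ≤ x → extend x ≡ x
  extend-≥ {x} n≤x with x <? n
  ... | yes x<n = contradiction x<n (≤⇒≯ n≤x)
  ... | no  _   = refl

data Position (n : ℕ) : ℕ → Set where
  inside  : ∀ i → Position n (toℕ {n} i)
  outside : ∀ {x} → n ≤ x → Position n x

position : ∀ n x → Position n x
position n x with x <? n
... | yes x<n = subst (Position n) (Fin.toℕ-fromℕ< x<n) (inside (fromℕ< x<n))
... | no  x≮n = outside (≮⇒≥ x≮n)

module _ {n} (π : Vec (Fin n) n) (inv : T (isInvolution π)) (av : T (avoids321 π)) where

  private
    σ : ℕ → ℕ
    σ = extend π

    invol     : ∀ x → σ (σ x) ≡ x
    invol x with position n x
    ... | inside i    = begin
      σ (σ (toℕ i))                   ≡⟨ cong σ (extend-toℕ π i) ⟩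
      σ (toℕ (lookup π i))            ≡⟨ extend-toℕ π (lookup π i) ⟩
      toℕ (lookup π (lookup π i))     ≡⟨ ≡ᵇ⇒≡ _ _ (all-allFin⁻ inv i) ⟩
      toℕ i                           ∎
      where open ≡-Reasoning
    ... | outside n≤x = trans (cong σ (extend-≥ π n≤x)) (extend-≥ π n≤x)

    inversion-inside : ∀ {x y} → x < y → σ y < σ x → y < n
    inversion-inside {x} {y} x<y σy<σx with position n y | position n x
    ... | inside j    | _           = Fin.toℕ<n j
    ... | outside n≤y | inside i    =
      contradiction (<-trans (subst₂ _<_ (extend-≥ π n≤y) (extend-toℕ π i) σy<σx) (Fin.toℕ<n (lookup π i))) (≤⇒≯ n≤y)
    ... | outside n≤y | outside n≤x =
      contradiction (subst₂ _<_ (extend-≥ π n≤y) (extend-≥ π n≤x) σy<σx) (<⇒≯ x<y)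

    no321 : ∀ {x y z} → x < y → y < z → σ y < σ x → σ z < σ y → ⊥
    no321 {x} {y} {z} x<y y<z σy<σx σz<σy
      with position n x | position n y | position n z | inversion-inside y<z σz<σy
    ... | inside i    | inside j    | inside k    | _   = T-not⁻ av (contains321⁺ π x<y y<z
      (subst₂ _<_ (extend-toℕ π j) (extend-toℕ π i) σy<σx) (subst₂ _<_ (extend-toℕ π k) (extend-toℕ π j) σz<σy))
    ... | outside n≤x | _           | _           | z<n = <⇒≱ (<-trans x<y (<-trans y<z z<n)) n≤x
    ... | _           | outside n≤y | _           | z<n = <⇒≱ (<-trans y<z z<n) n≤y
    ... | _           | _           | outside n≤z | z<n = <⇒≱ z<n n≤z

    -- Otherwise there is a 321: at positions σ y < x < y with values y > x > σ y if σ x = x, and at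
    -- σ y < σ x < x with values y > x > σ x if σ x < x.
    excedance : ∀ {x y} → x < y → σ y < σ x → x < σ x
    excedance {x} {y} x<y σy<σx with <-cmp x (σ x)
    ... | tri< x<σx _ _ = x<σx
    ... | tri≈ _ x≡σx _ = ⊥-elim (no321 (subst (σ y <_) (sym x≡σx) σy<σx) x<y
                                        (subst₂ _<_ x≡σx (sym (invol y)) x<y) σy<σx)
    ... | tri> _ _ σx<x = ⊥-elim (no321 σy<σx σx<x
                                        (subst₂ _<_ (sym (invol x)) (sym (invol y)) x<y)
                                        (subst (σ x <_) (sym (invol x)) σx<x))

    -- Otherwise there is a 321: at positions x < y < σ x with values σ x > y > x if σ y = y, and at
    -- x < y < σ y with values σ x > σ y > y if σ y > y.
    deficiency : ∀ {x y} → x < y → σ y < σ x → σ y < y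
    deficiency {x} {y} x<y σy<σx with <-cmp (σ y) y
    ... | tri< σy<y _ _ = σy<y
    ... | tri≈ _ σy≡y _ = ⊥-elim (no321 x<y (subst (_< σ x) σy≡y σy<σx) σy<σx
                                        (subst₂ _<_ (sym (invol x)) (sym σy≡y) x<y))
    ... | tri> _ _ y<σy = ⊥-elim (no321 x<y y<σy σy<σx (subst (_< σ y) (sym (invol y)) y<σy))

  extend-partial : Partial n 0 (extend π)
  extend-partial = record
    { invol     = invol
    ; beyond    = λ n≤x → extend-≥ π (≤-trans (≤-reflexive (sym (+-identityʳ n))) n≤x)
    ; pending   = λ n≤x x<n → contradiction (<-≤-trans x<n (≤-reflexive (+-identityʳ n))) (≤⇒≯ n≤x)
    ; inversion = λ x<y σy<σx → excedance x<y σy<σx , deficiency x<y σy<σx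
    }

decode-< : ∀ {n} (p : Path n 0) i → decode p (toℕ {n} i) < n
decode-< {n} p i = <-≤-trans
  (Partial.bounded (decode-partial p) (<-≤-trans (Fin.toℕ<n i) (m≤m+n n 0))) (≤-reflexive (+-identityʳ n))

pathVec : ∀ {n} → Path n 0 → Vec (Fin n) n
pathVec p = tabulate λ i → fromℕ< (decode-< p i)

lookup-pathVec : ∀ {n} (p : Path n 0) i → toℕ (lookup (pathVec p) i) ≡ decode p (toℕ i)
lookup-pathVec p i = trans (cong toℕ (Vec.lookup∘tabulate _ i)) (Fin.toℕ-fromℕ< (decode-< p i))

pathVec-injective : ∀ {n} {p q : Path n 0} → pathVec p ≡ pathVec q → p ≡ q
pathVec-injective {n} {p} {q} eq = decode-injective p q λ x → case position n x of λ where
  (inside i)    → trans (sym (lookup-pathVec p i)) (trans (cong (λ v → toℕ (lookup v i)) eq) (lookup-pathVec q i))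
  (outside n≤x) → let n+0≤x = ≤-trans (≤-reflexive (+-identityʳ n)) n≤x in
                  trans (Partial.beyond (decode-partial p) n+0≤x) (sym (Partial.beyond (decode-partial q) n+0≤x))

pathVec-isInvolution : ∀ {n} (p : Path n 0) → T (isInvolution (pathVec p))
pathVec-isInvolution p = all-allFin⁺ λ i → ≡⇒≡ᵇ _ _ (begin
  toℕ (lookup (pathVec p) (lookup (pathVec p) i))   ≡⟨ lookup-pathVec p (lookup (pathVec p) i) ⟩
  decode p (toℕ (lookup (pathVec p) i))             ≡⟨ cong (decode p) (lookup-pathVec p i) ⟩
  decode p (decode p (toℕ i))                       ≡⟨ Partial.invol (decode-partial p) (toℕ i) ⟩
  toℕ i                                             ∎)
  where open ≡-Reasoning

-- The middle entry of a 321 would be the right end of one inversion and the left end of another,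
-- hence both a D and a U.
pathVec-avoids321 : ∀ {n} (p : Path n 0) → T (avoids321 (pathVec p))
pathVec-avoids321 p = T-not⁺ λ t →
  let i , j , k , i<j , j<k , ji , kj = contains321⁻ (pathVec p) t
      _ , πj<j = inversion i<j (subst₂ _<_ (lookup-pathVec p j) (lookup-pathVec p i) ji)
      j<πj , _ = inversion j<k (subst₂ _<_ (lookup-pathVec p k) (lookup-pathVec p j) kj)
  in <⇒≯ πj<j j<πj
  where open Partial (decode-partial p)

pathVec-surjective : ∀ {n} (π : Vec (Fin n) n) → T (isInvolution π) → T (avoids321 π) → ∃ λ p → pathVec p ≡ π
pathVec-surjective {n} π inv av = let p , eq = decode-surjective n (extend-partial π inv av) in
  p , trans (Vec.tabulate-cong λ i → Fin.toℕ-injective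
        (trans (Fin.toℕ-fromℕ< (decode-< p i)) (trans (eq (toℕ i)) (extend-toℕ π i))))
      (Vec.tabulate∘lookup π)

I321↭pathVecs : ∀ n → I321 n ↭ map pathVec (allPaths n 0)
I321↭pathVecs n = ∼bag⇒↭ (unique∧set⇒bag
  (Unique.filter⁺ P? (allVecs-unique n n))
  (Unique.map⁺ pathVec-injective (allPaths-unique n 0))
  (mk⇔ to from))
  where
  P? = λ (π : Vec (Fin n) n) → T? (isInvolution π ∧ avoids321 π)
  to : ∀ {π} → π ∈ I321 n → π ∈ map pathVec (allPaths n 0)
  to {π} π∈ with inv , av ← Equivalence.to T-∧ (proj₂ (∈-filter⁻ P? {xs = allVecs n n} π∈))
            with p , refl ← pathVec-surjective π inv av = ∈-map⁺ pathVec (allPaths-complete p)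
  from : ∀ {π} → π ∈ map pathVec (allPaths n 0) → π ∈ I321 n
  from π∈ with p , _ , refl ← ∈-map⁻ pathVec π∈ = ∈-filter⁺ P? (allVecs-complete (pathVec p))
    (Equivalence.from T-∧ (pathVec-isInvolution p , pathVec-avoids321 p))

-- The major index of a path

majFrom-∷ʳ : ∀ p xs x y → majFrom p (xs ∷ʳ x ∷ʳ y) ≡
             (if y <ᵇ x then p + length xs else 0) + majFrom p (xs ∷ʳ x)
majFrom-∷ʳ p []           x y = cong (λ k → (if y <ᵇ x then k else 0) + 0) (sym (+-identityʳ p))
majFrom-∷ʳ p (z ∷ [])     x y = begin
  a + (d (suc p) + 0)   ≡⟨ x∙yz≈y∙xz a (d (suc p)) 0 ⟩
  d (suc p) + (a + 0)   ≡⟨ cong (λ k → d k + (a + 0)) (+-comm 1 p) ⟩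
  d (p + 1) + (a + 0)   ∎
  where
  open ≡-Reasoning
  a = if x <ᵇ z then p else 0
  d : ℕ → ℕ
  d k = if y <ᵇ x then k else 0
majFrom-∷ʳ p (z ∷ w ∷ xs) x y = begin
  a + majFrom (suc p) ((w ∷ xs) ∷ʳ x ∷ʳ y)     ≡⟨ cong (a +_) (majFrom-∷ʳ (suc p) (w ∷ xs) x y) ⟩
  a + (d (suc p + length (w ∷ xs)) + m)        ≡⟨ x∙yz≈y∙xz a _ m ⟩
  d (suc p + length (w ∷ xs)) + (a + m)        ≡⟨ cong (λ k → d k + (a + m)) (+-suc p (length (w ∷ xs))) ⟨
  d (p + length (z ∷ w ∷ xs)) + (a + m)        ∎
  where
  open ≡-Reasoning
  a = if w <ᵇ z then p else 0
  m = majFrom (suc p) ((w ∷ xs) ∷ʳ x)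
  d : ℕ → ℕ
  d k = if y <ᵇ x then k else 0

-- `majFrom` recurses from the front and `descents` from the back, so the last pair is peeled off
-- with `majFrom-∷ʳ`.
majFrom-applyUpTo : ∀ π n → majFrom 1 (applyUpTo π n) ≡ descents π n
majFrom-applyUpTo π zero          = refl
majFrom-applyUpTo π (suc zero)    = refl
majFrom-applyUpTo π (suc (suc n)) = begin
  majFrom 1 (applyUpTo π (2 + n))
    ≡⟨ cong (majFrom 1) (List.applyUpTo-∷ʳ π (suc n)) ⟨
  majFrom 1 (applyUpTo π (suc n) ∷ʳ π (suc n))
    ≡⟨ cong (λ xs → majFrom 1 (xs ∷ʳ π (suc n))) (List.applyUpTo-∷ʳ π n) ⟨
  majFrom 1 (applyUpTo π n ∷ʳ π n ∷ʳ π (suc n))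
    ≡⟨ majFrom-∷ʳ 1 (applyUpTo π n) (π n) (π (suc n)) ⟩
  d (suc (length (applyUpTo π n))) + majFrom 1 (applyUpTo π n ∷ʳ π n)
    ≡⟨ cong₂ (λ k xs → d (suc k) + majFrom 1 xs) (List.length-applyUpTo π n) (List.applyUpTo-∷ʳ π n) ⟩
  d (suc n) + majFrom 1 (applyUpTo π (suc n))
    ≡⟨ cong (d (suc n) +_) (majFrom-applyUpTo π (suc n)) ⟩
  d (suc n) + descents π (suc n) ∎
  where
  open ≡-Reasoning
  d : ℕ → ℕ
  d k = if π (suc n) <ᵇ π n then k else 0

toList-tabulate : ∀ {A : Set} (f : ℕ → A) n {g : Fin n → A} → g ≗ f ∘ toℕ → toList (tabulate g) ≡ applyUpTo f n
toList-tabulate f zero    eq = refl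
toList-tabulate f (suc n) eq = cong₂ _∷_ (eq Fin.zero) (toList-tabulate (f ∘ suc) n (eq ∘ Fin.suc))

maj-pathVec : ∀ {n} (p : Path n 0) → maj (pathVec p) ≡ pathMaj p
maj-pathVec {n} p = begin
  majFrom 1 (toList (Vec.map toℕ (pathVec p)))
    ≡⟨ cong (majFrom 1 ∘ toList) (Vec.tabulate-∘ toℕ (λ i → fromℕ< (decode-< p i))) ⟨
  majFrom 1 (toList (tabulate λ i → toℕ (fromℕ< (decode-< p i))))
    ≡⟨ cong (majFrom 1) (toList-tabulate (decode p) n λ i → Fin.toℕ-fromℕ< (decode-< p i)) ⟩
  majFrom 1 (applyUpTo (decode p) n)
    ≡⟨ majFrom-applyUpTo (decode p) n ⟩
  descents (decode p) n
    ≡⟨ descents-decode p ⟩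
  pathMaj p ∎
  where open ≡-Reasoning

majGF≋pathGF : ∀ n → majGF n ≋ pathGF n 0
majGF≋pathGF n = begin
  ∑ (qPow ∘ maj) (I321 n)                       ≈⟨ ∑-↭ (qPow ∘ maj) (I321↭pathVecs n) ⟩
  ∑ (qPow ∘ maj) (map pathVec (allPaths n 0))   ≡⟨ cong sumP (List.map-∘ (allPaths n 0)) ⟨
  ∑ (qPow ∘ maj ∘ pathVec) (allPaths n 0)       ≡⟨ cong sumP (List.map-cong (cong qPow ∘ maj-pathVec) (allPaths n 0)) ⟩
  pathGF n 0                                    ∎
  where open ≋-Reasoning

theorem3p3 : (n : ℕ) → n ≥ 1 → IsQBinom (majGF n) n (n / 2)
theorem3p3 n _ = _≋_.at (begin
  majGF n *P qbinomDenom k           ≈⟨ *P-cong (majGF≋pathGF n) ≋-refl ⟩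
  pathGF n 0 *P qbinomDenom k        ≡⟨ cong (λ m → pathGF m 0 *P qbinomDenom k) n≡k+b ⟩
  pathGF (k + b) 0 *P qbinomDenom k  ≈⟨ *P-cong (pathGF≋gauss k b 0 (n % 2) (s≤s⁻¹ (m%n<n n 2)) refl) ≋-refl ⟩
  gauss k b *P qbinomDenom k         ≈⟨ gauss-isQBinom k b ⟩
  qbinomNumer (k + b) k              ≡⟨ cong (λ m → qbinomNumer m k) n≡k+b ⟨
  qbinomNumer n k                    ∎)
  where
  open ≋-Reasoning
  k b : ℕ
  k = n / 2
  -- This is n - ⌊n/2⌋, in the form that makes the equation required by `pathGF≋gauss` at height 0
  -- with `e = n % 2` hold by `refl`.
  b = k + n % 2
  n≡k+b : n ≡ k + b
  n≡k+b = trans (m≡m%n+[m/n]*n n 2) (rearrange (n % 2) k)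
    where
    rearrange : ∀ r q → r + q * 2 ≡ q + (q + r)
    rearrange = solveℕ
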